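{- For any $t,N\in\mathbb{N}$ there are $K,n_0\in\mathbb{N}$ such that if $\mathcal{F}\subset[m]^n$ is $(t-1)$-avoiding with $n\ge n_0$ and $m\ge 2^{n/N}$, then there exists a subcube $D$ of co-dimension $t$ such that $\mu(\mathcal{F}\setminus D)\le 2^{ -n/K}m^{ -t}$.
   Context: $\mu$ is the uniform probability measure on $[m]^n$; $\mathcal{F}$ is $(t-1)$-avoiding if no $x,y\in\mathcal{F}$ satisfy $|\{i:x_i=y_i\}|=t-1$. A subcube of co-dimension $t$ is a set $\{x\in[m]^n:x_R=\alpha\}$ with $R\subset[n]$, $|R|=t$, $\alpha\in[m]^R$. -}

module Defs where

open import Algebra.Definitions.RawSemiring using () renaming (_^_ to pow)
open import Data.Fin using (Fin; _≟_)
open import Data.Fin.Properties using (all?)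
open import Data.Fin.Subset using (Subset; ∣_∣; _∈_)
open import Data.Fin.Subset.Properties using (_∈?_)
open import Data.Integer using (+_)
open import Data.List using (List; []; _∷_; allFin; cartesianProductWith; filter; length)
open import Data.Nat using (ℕ; zero; suc; NonZero; _^_; _≤_)
open import Data.Nat.Properties using (m^n≢0)
import Data.Rational.Unnormalised as ℚᵘ
open ℚᵘ using (ℚᵘ; ½)
open import Data.Vec using (Vec; []; _∷_; lookup)
open import Level using (0ℓ)
open import Relation.Binary.PropositionalEquality using (_≡_; _≢_)
open import Relation.Nullary using (Dec; yes; no; contradiction)
open import Relation.Nullary.Decidable using (map′)
open import Relation.Unary using (Pred; Decidable; _∖_)
open import Relation.Unary.Properties using (_∩?_; ∁?)

-- Elements of [m]^n.
Word : ℕ → ℕ → Set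
Word m n = Vec (Fin m) n

-- Each word occurs exactly once in this list.
words : ∀ m n → List (Word m n)
words m zero    = [] ∷ []
words m (suc n) = cartesianProductWith _∷_ (allFin m) (words m n)

card : ∀ {m n} {A : Pred (Word m n) 0ℓ} → Decidable A → ℕ
card {m} {n} A? = length (filter A? (words m n))

μ : ∀ {m n} .{{_ : NonZero m}} {A : Pred (Word m n) 0ℓ} → Decidable A → ℚᵘ
μ {m} {n} A? = (+ card A?) ℚᵘ./ (m ^ n)
  where instance _ = m^n≢0 m n

agreement : ∀ {m n} → Word m n → Word m n → ℕ
agreement {n = n} x y = length (filter (λ i → lookup x i ≟ lookup y i) (allFin n))

-- The words x and y are not required to be distinct.
Avoiding : ∀ {m n} → ℕ → Pred (Word m n) 0ℓ → Set
Avoiding s F = ∀ x y → F x → F y → agreement x y ≢ s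

-- The data (R , α) with |R| = t and α ∈ [m]^R.  Membership proofs are
-- irrelevant arguments of α, so α is a function on R.
record Subcube (m n t : ℕ) : Set where
  field
    R     : Subset n
    ∣R∣≡t : ∣ R ∣ ≡ t
    α     : ∀ i → .(i ∈ R) → Fin m

  Points : Pred (Word m n) 0ℓ
  Points x = ∀ i (i∈R : i ∈ R) → lookup x i ≡ α i i∈R

  points? : Decidable Points
  points? x = all? agrees?
    where
    agrees? : ∀ i → Dec ((i∈R : i ∈ R) → lookup x i ≡ α i i∈R)
    agrees? i with i ∈? R
    ... | yes i∈R = map′ (λ e _ → e) (λ f → f i∈R) (lookup x i ≟ α i i∈R)
    ... | no  i∉R = yes (λ i∈R → contradiction i∈R i∉R)

open Subcube public using (Points; points?)

_∖?_ : ∀ {m n} {A B : Pred (Word m n) 0ℓ} →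
       Decidable A → Decidable B → Decidable (A ∖ B)
A? ∖? B? = A? ∩? ∁? B?

-- 2^(n/N) ≤ m for the real exponent n/N: both sides are nonnegative, so this
-- is the same as the inequality between their N-th powers.
2^[_/_]≤_ : (n N : ℕ) .{{_ : NonZero N}} → ℕ → Set
2^[ n / N ]≤ m = 2 ^ n ≤ m ^ N

infixr 8 _^ᵘ_
_^ᵘ_ : ℚᵘ → ℕ → ℚᵘ
_^ᵘ_ = pow ℚᵘ.+-*-rawSemiring

-- p ≤ 2^(-n/K) · q for the real exponent -n/K and p, q ≥ 0, again by
-- comparing K-th powers.
_≤2^[-_/_]*_ : ℚᵘ → (n K : ℕ) .{{_ : NonZero K}} → ℚᵘ → Set
p ≤2^[- n / K ]* q = p ^ᵘ K ℚᵘ.≤ (½ ^ᵘ n) ℚᵘ.* (q ^ᵘ K)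

{-# OPTIONS --safe #-}

-- A set A without a pair agreeing exactly on t coordinates has a coordinate
-- value taken by a large proportion of A, unless A is very small: for each of
-- k blocks R of coordinates, the words of A with a common restriction to R all
-- agree somewhere else with one of them, so after passing to a proportion of
-- 1/n of A the restriction to R determines another coordinate; if no value is
-- popular, the k resulting equations are nearly independent and each of them
-- is unlikely.  Iterating t + 1 times, all of F up to a negligible measure is
-- covered by subcubes of co-dimension t + 1 in which F is heavy (has density
-- at least about m^-δ with δ < 1).  In two different heavy subcubes, typical words of F
-- never have the same restriction to a block, since otherwise the coordinates
-- of the block could be used to raise the agreement to exactly t.  So, if p
-- and p′ are the proportions of values on a block that are typical for the two
-- subcubes, then p + p′ ≤ 1 and p p′ ≤ 1/4.  Multiplying over linearly many
-- blocks, all heavy subcubes but the one in which F is largest have density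
-- exponentially small in n, and disjointness of the typical values also
-- controls the sum of these densities.
module Submission where

open import Defs
open import Data.Bool using (Bool; if_then_else_)
open import Data.Empty using (⊥; ⊥-elim)
open import Data.Fin using (Fin; zero; suc; toℕ; fromℕ<; _≟_)
open import Data.Fin.Properties using (all?; any?; ¬∀⟶∃¬; toℕ<n; toℕ-fromℕ<)
open import Data.Fin.Subset using (Subset; inside; outside; ∣_∣; _∈_; _∉_; _⊆_; _∪_; _∩_; ∁; ⁅_⁆; ⊤) renaming (⊥ to ∅)
open import Data.Fin.Subset.Properties using (_∈?_; x∈p∪q⁻; x∈p∪q⁺; x∈p∩q⁺; x∈p∩q⁻; x∈⁅x⁆; x∈⁅y⁆⇒x≡y; ∣⁅x⁆∣≡1; p⊂q⇒∣p∣<∣q∣; x∈∁p⇒x∉p; ∣∁p∣≡n∸∣p∣; ∣⊤∣≡n; ∣⊥∣≡0; ∉⊥)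
import Data.Integer as ℤ
open import Data.Integer.Properties using (pos-*)
open import Data.List using (List; []; _∷_; _++_; map; allFin; cartesianProductWith; filter; length; cartesianProduct)
open import Data.List.Membership.Propositional using (find; lose) renaming (_∈_ to _∈ˡ_)
open import Data.List.Membership.Propositional.Properties using (∈-allFin; ∈-cartesianProductWith⁺; ∈-map⁺; ∈-++⁺ˡ; ∈-++⁺ʳ; ∈-filter⁺; ∈-cartesianProduct⁺)
open import Data.List.Properties using (map-++; map-∘; map-tabulate; length-tabulate; length-map; length-++)
open import Data.List.Relation.Unary.All using () renaming (lookup to allLookup)
open import Data.List.Relation.Unary.All.Properties using (all-filter)
open import Data.List.Relation.Unary.Any using (Any; here; there) renaming (any? to anyˡ?; map to anyMap)
open import Data.Nat hiding (_≟_; _/_)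
open import Data.Nat.DivMod using (_%_; m≡m%n+[m/n]*n; m%n<n; m/n*n≤m; m*n/n≡m; /-monoˡ-≤) renaming (_/_ to _div_)
open import Data.Nat.ListAction using (sum)
open import Data.Nat.ListAction.Properties using (sum-++)
open import Data.Nat.Properties renaming (_≟_ to _≟ⁿ_)
open import Data.List.Extrema ≤-totalOrder using (argmax; argmax-all; f[xs]≤f[argmax])
open import Data.Nat.Tactic.RingSolver using (solve-∀)
open import Data.Product using (Σ-syntax; ∃; ∃-syntax; _×_; _,_; proj₁; proj₂)
open import Data.Rational.Unnormalised using (ℚᵘ; ½; _/_)
import Data.Rational.Unnormalised as ℚᵘ
open import Data.Sum using (_⊎_; inj₁; inj₂; [_,_]′)
open import Data.Vec using ([]; _∷_; lookup; here; there; _[_]≔_; replicate; tabulate)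
open import Data.Vec.Properties using (lookup∘update; lookup∘update′; lookup∘tabulate; lookup⇒[]=; []=⇒lookup)
open import Function using (_∘_; id)
open import Level using (0ℓ)
open import Relation.Binary.PropositionalEquality using (_≡_; _≢_; refl; sym; trans; cong; cong₂; subst; subst₂; _≗_)
open import Relation.Nullary using (Dec; yes; no; ¬_; does; contradiction)
open import Relation.Nullary.Decidable using (_×-dec_; _→-dec_; ¬?; decidable-stable; dec-true; dec-false)
open import Relation.Unary using (Pred; Decidable)

-- The obstacle in the last step is that one set `S` of t + 1 coordinates carries m^(t+1) subcubes
-- and m has no upper bound in terms of n, so exponentially small bounds for single subcubes cannot
-- be added up; a union bound is affordable only over the polynomially many sets `S`. For fixed `S`,
-- the proportions p of typical restrictions to a block sum to at most 1 over all these subcubes.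
-- Two blocks bound the density of `F` inside a subcube by 2 p₁ p₂, and comparison with the largest
-- section bounds it by 2 · 4^-l. The geometric mean of the two bounds is at most 2^-l (p₁ + p₂),
-- which is linear in the proportions, hence summable, and still exponentially small. The cutoff `h`
-- for popularity has to meet two demands. Iterating costs a factor of about h^(t+1), which must
-- stay well below m, since atypical words can fill a proportion of about 1/m of a subcube. A set
-- without popular values has measure about h^-k, which must fall below m^-(t+1). A small power of m
-- for `h` and a large constant k achieve both.

private variable
  X Y I : Set
  m n : ℕ

-- Sums and counting

∑ : List X → (X → ℕ) → ℕ
∑ xs f = sum (map f xs)

infix 5 ∑
syntax ∑ xs (λ x → e) = ∑[ x ← xs ] e

module _ {f g : X → ℕ} where

  ∑-mono : ∀ xs → (∀ x → f x ≤ g x) → ∑ xs f ≤ ∑ xs g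
  ∑-mono []       f≤g = z≤n
  ∑-mono (x ∷ xs) f≤g = +-mono-≤ (f≤g x) (∑-mono xs f≤g)

  ∑-cong : ∀ xs → f ≗ g → ∑ xs f ≡ ∑ xs g
  ∑-cong []       f≗g = refl
  ∑-cong (x ∷ xs) f≗g = cong₂ _+_ (f≗g x) (∑-cong xs f≗g)

∑-+ : (xs : List X) (f g : X → ℕ) → ∑[ x ← xs ] (f x + g x) ≡ ∑ xs f + ∑ xs g
∑-+ []       f g = refl
∑-+ (x ∷ xs) f g = trans (cong (f x + g x +_) (∑-+ xs f g))
                         (interchange (f x) (g x) (∑ xs f) (∑ xs g))
  where
  interchange : ∀ a b c d → a + b + (c + d) ≡ a + c + (b + d)
  interchange = solve-∀

∑-*ˡ : (xs : List X) (c : ℕ) (f : X → ℕ) → ∑[ x ← xs ] (c * f x) ≡ c * ∑ xs f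
∑-*ˡ []       c f = sym (*-zeroʳ c)
∑-*ˡ (x ∷ xs) c f = trans (cong (c * f x +_) (∑-*ˡ xs c f)) (sym (*-distribˡ-+ c (f x) (∑ xs f)))

∑-*ʳ : (xs : List X) (f : X → ℕ) (c : ℕ) → ∑[ x ← xs ] (f x * c) ≡ ∑ xs f * c
∑-*ʳ xs f c = trans (∑-cong xs (λ x → *-comm (f x) c)) (trans (∑-*ˡ xs c f) (*-comm c _))

∑-const : (xs : List X) (c : ℕ) → ∑[ _ ← xs ] c ≡ length xs * c
∑-const []       c = refl
∑-const (x ∷ xs) c = cong (c +_) (∑-const xs c)

∑-bound : {f : X → ℕ} (xs : List X) {c : ℕ} → (∀ x → f x ≤ c) → ∑ xs f ≤ length xs * c
∑-bound xs {c} f≤c = ≤-trans (∑-mono xs f≤c) (≤-reflexive (∑-const xs c))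

∑-swap : (xs : List X) (ys : List Y) (f : X → Y → ℕ) →
         ∑[ x ← xs ] ∑[ y ← ys ] f x y ≡ ∑[ y ← ys ] ∑[ x ← xs ] f x y
∑-swap []       ys f = sym (trans (∑-const ys 0) (*-zeroʳ (length ys)))
∑-swap (x ∷ xs) ys f = trans (cong (∑ ys (f x) +_) (∑-swap xs ys f))
                             (sym (∑-+ ys (f x) (λ y → ∑[ x′ ← xs ] f x′ y)))

∑-∈ : {f : X → ℕ} {x : X} {xs : List X} → x ∈ˡ xs → f x ≤ ∑ xs f
∑-∈ (here refl) = m≤m+n _ _
∑-∈ (there x∈)  = ≤-trans (∑-∈ x∈) (m≤n+m _ _)

∑-witness : {f : X → ℕ} (xs : List X) → 0 < ∑ xs f → ∃[ x ] 0 < f x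
∑-witness {f = f} (x ∷ xs) 0<∑ with f x in eq
... | zero  = ∑-witness xs 0<∑
... | suc _ = x , subst (0 <_) (sym eq) z<s

∑-++ : (xs ys : List X) (f : X → ℕ) → ∑ (xs ++ ys) f ≡ ∑ xs f + ∑ ys f
∑-++ xs ys f = trans (cong sum (map-++ f xs ys)) (sum-++ (map f xs) (map f ys))

∑-map : (g : X → Y) (xs : List X) (f : Y → ℕ) → ∑ (map g xs) f ≡ ∑ xs (f ∘ g)
∑-map g xs f = cong sum (sym (map-∘ xs))

∑-cartesianProductWith : (g : X → Y → I) (xs : List X) (ys : List Y) (f : I → ℕ) →
  ∑ (cartesianProductWith g xs ys) f ≡ ∑[ x ← xs ] ∑[ y ← ys ] f (g x y)
∑-cartesianProductWith g []       ys f = refl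
∑-cartesianProductWith g (x ∷ xs) ys f =
  trans (∑-++ (map (g x) ys) _ f)
        (cong₂ _+_ (∑-map (g x) ys f) (∑-cartesianProductWith g xs ys f))

∑-allFin-suc : (f : Fin (suc n) → ℕ) → ∑ (allFin (suc n)) f ≡ f zero + ∑ (allFin n) (f ∘ suc)
∑-allFin-suc {n} f = cong (f zero +_)
  (trans (cong (λ l → ∑ l f) (sym (map-tabulate id suc))) (∑-map suc (allFin n) f))

∑-words : (f : Word m (suc n) → ℕ) →
          ∑ (words m (suc n)) f ≡ ∑[ a ← allFin m ] ∑[ x ← words m n ] f (a ∷ x)
∑-words {m} {n} f = ∑-cartesianProductWith _∷_ (allFin m) (words m n) f

length-allFin : ∀ n → length (allFin n) ≡ n
length-allFin n = length-tabulate {n = n} id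

χ : {P : Set} → Dec P → ℕ
χ P? = if does P? then 1 else 0

module _ {P : Set} where

  χ-yes : (P? : Dec P) → P → χ P? ≡ 1
  χ-yes (yes _) _ = refl
  χ-yes (no ¬p) p = contradiction p ¬p

  χ≤1 : (P? : Dec P) → χ P? ≤ 1
  χ≤1 (yes _) = ≤-refl
  χ≤1 (no _)  = z≤n

  χ-witness : (P? : Dec P) → 0 < χ P? → P
  χ-witness (yes p) _ = p

  χ-≤ : (P? : Dec P) {k : ℕ} → (P → 1 ≤ k) → χ P? ≤ k
  χ-≤ (yes p) h = h p
  χ-≤ (no _)  h = z≤n

  χ-* : (P? : Dec P) {a b : ℕ} → (P → a ≤ b) → χ P? * a ≤ χ P? * b
  χ-* (yes p) h = *-monoʳ-≤ 1 (h p)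
  χ-* (no _)  h = z≤n

module _ {P Q : Set} where

  χ-mono : (P? : Dec P) (Q? : Dec Q) → (P → Q) → χ P? ≤ χ Q?
  χ-mono P? Q? h = χ-≤ P? (λ p → ≤-reflexive (sym (χ-yes Q? (h p))))

module _ {P Q : Set} where

  χ-cong : (P? : Dec P) (Q? : Dec Q) → (P → Q) → (Q → P) → χ P? ≡ χ Q?
  χ-cong P? Q? f g = ≤-antisym (χ-mono P? Q? f) (χ-mono Q? P? g)

  χ-× : (P? : Dec P) (Q? : Dec Q) → χ (P? ×-dec Q?) ≡ χ P? * χ Q?
  χ-× (no _)  _  = refl
  χ-× (yes _) Q? = sym (*-identityˡ (χ Q?))

∑-≟ : ∀ {m} (c : Fin m) → ∑[ a ← allFin m ] χ (a ≟ c) ≡ 1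
∑-≟ {suc m} zero    = trans (∑-allFin-suc {n = m} (λ a → χ (a ≟ zero)))
                            (cong suc (trans (∑-const (allFin m) 0) (*-zeroʳ (length (allFin m)))))
∑-≟ {suc m} (suc c) = trans (∑-allFin-suc {n = m} (λ a → χ (a ≟ suc c)))
  (trans (∑-cong (allFin m) (λ a → χ-cong (suc a ≟ suc c) (a ≟ c) (λ { refl → refl }) (cong suc)))
         (∑-≟ c))

length-filter-∑ : {P : Pred X 0ℓ} (P? : Decidable P) (xs : List X) →
                  length (filter P? xs) ≡ ∑[ x ← xs ] χ (P? x)
length-filter-∑ P? []       = refl
length-filter-∑ P? (x ∷ xs) with P? x
... | yes _ = cong suc (length-filter-∑ P? xs)
... | no _  = length-filter-∑ P? xs

∈-words : (x : Word m n) → x ∈ˡ words m n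
∈-words []      = here refl
∈-words (a ∷ x) = ∈-cartesianProductWith⁺ _∷_ (∈-allFin a) (∈-words x)

length-words : ∀ m n → length (words m n) ≡ m ^ n
length-words m n = trans (sym (*-identityʳ _)) (trans (sym (∑-const (words m n) 1)) (go n))
  where
  go : ∀ n → ∑[ _ ← words m n ] 1 ≡ m ^ n
  go zero    = refl
  go (suc n) = trans (∑-words {m} {n} (λ _ → 1))
    (trans (∑-cong (allFin m) (λ _ → go n))
    (trans (∑-const (allFin m) (m ^ n)) (cong (_* m ^ n) (length-allFin m))))

card-∑ : {P : Pred (Word m n) 0ℓ} (P? : Decidable P) → card P? ≡ ∑[ x ← words m n ] χ (P? x)
card-∑ {m} {n} P? = length-filter-∑ P? (words m n)

module _ {P : Pred (Word m n) 0ℓ} (P? : Decidable P) where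

  card≤m^n : card P? ≤ m ^ n
  card≤m^n = begin
    card P?                       ≡⟨ card-∑ P? ⟩
    ∑[ x ← words m n ] χ (P? x)   ≤⟨ ∑-bound (words m n) (λ x → χ≤1 (P? x)) ⟩
    length (words m n) * 1        ≡⟨ *-identityʳ _ ⟩
    length (words m n)            ≡⟨ length-words m n ⟩
    m ^ n                         ∎
    where open ≤-Reasoning

  card-witness : 0 < card P? → ∃ P
  card-witness 0<c with x , 0<χ ← ∑-witness (words m n) (subst (0 <_) (card-∑ P?) 0<c) =
    x , χ-witness (P? x) 0<χ

  card-pos : ∀ {x} → P x → 0 < card P?
  card-pos {x} Px = subst (0 <_) (sym (card-∑ P?))
    (≤-trans (≤-reflexive (sym (χ-yes (P? x) Px))) (∑-∈ (∈-words x)))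

  card-empty : (∀ x → ¬ P x) → card P? ≡ 0
  card-empty ¬P with card P? in eq
  ... | zero  = refl
  ... | suc _ with x , Px ← card-witness (subst (0 <_) (sym eq) z<s) = contradiction Px (¬P x)

module _ {P Q : Pred (Word m n) 0ℓ} (P? : Decidable P) (Q? : Decidable Q) where

  card-mono : (∀ x → P x → Q x) → card P? ≤ card Q?
  card-mono P⊆Q = subst₂ _≤_ (sym (card-∑ P?)) (sym (card-∑ Q?))
    (∑-mono (words m n) (λ x → χ-mono (P? x) (Q? x) (P⊆Q x)))

card-∪ : {P Q R : Pred (Word m n) 0ℓ} (P? : Decidable P) (Q? : Decidable Q) (R? : Decidable R) →
         (∀ x → P x → Q x ⊎ R x) → card P? ≤ card Q? + card R?
card-∪ {m} {n} P? Q? R? P⊆Q∪R = begin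
  card P?                                   ≡⟨ card-∑ P? ⟩
  ∑[ x ← words m n ] χ (P? x)               ≤⟨ ∑-mono (words m n) (λ x → χ-≤ (P? x) (λ p → split x (P⊆Q∪R x p))) ⟩
  ∑[ x ← words m n ] (χ (Q? x) + χ (R? x))  ≡⟨ ∑-+ (words m n) _ _ ⟩
  (∑[ x ← words m n ] χ (Q? x)) + (∑[ x ← words m n ] χ (R? x)) ≡⟨ sym (cong₂ _+_ (card-∑ Q?) (card-∑ R?)) ⟩
  card Q? + card R?                         ∎
  where
  open ≤-Reasoning
  split : ∀ x → _ → 1 ≤ χ (Q? x) + χ (R? x)
  split x (inj₁ q) = ≤-trans (≤-reflexive (sym (χ-yes (Q? x) q))) (m≤m+n _ _)
  split x (inj₂ r) = ≤-trans (≤-reflexive (sym (χ-yes (R? x) r))) (m≤n+m _ _)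

card-⋃ : {P : Pred (Word m n) 0ℓ} {Q : I → Pred (Word m n) 0ℓ} (P? : Decidable P)
         (is : List I) (Q? : ∀ i → Decidable (Q i)) →
         (∀ x → P x → ∃[ i ] (i ∈ˡ is) × Q i x) → card P? ≤ ∑[ i ← is ] card (Q? i)
card-⋃ {m} {n} P? is Q? P⊆⋃Q = begin
  card P?                                       ≡⟨ card-∑ P? ⟩
  ∑[ x ← words m n ] χ (P? x)                   ≤⟨ ∑-mono (words m n) (λ x → χ-≤ (P? x) (λ p → pick x (P⊆⋃Q x p))) ⟩
  ∑[ x ← words m n ] ∑[ i ← is ] χ (Q? i x)     ≡⟨ ∑-swap (words m n) is _ ⟩
  ∑[ i ← is ] ∑[ x ← words m n ] χ (Q? i x)     ≡⟨ sym (∑-cong is (λ i → card-∑ (Q? i))) ⟩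
  ∑[ i ← is ] card (Q? i)                       ∎
  where
  open ≤-Reasoning
  pick : ∀ x → _ → 1 ≤ ∑[ i ← is ] χ (Q? i x)
  pick x (i , i∈is , q) = ≤-trans (≤-reflexive (sym (χ-yes (Q? i x) q))) (∑-∈ i∈is)

-- Cells of words with prescribed coordinates

infix 4 _≈[_]_ _≈?[_]_

_≈[_]_ : Word m n → Subset n → Word m n → Set
x ≈[ S ] y = ∀ i → i ∈ S → lookup x i ≡ lookup y i

_≈?[_]_ : (x : Word m n) (S : Subset n) (y : Word m n) → Dec (x ≈[ S ] y)
x ≈?[ S ] y = all? (λ i → (i ∈? S) →-dec (lookup x i ≟ lookup y i))

≈-sym : {S : Subset n} {x y : Word m n} → x ≈[ S ] y → y ≈[ S ] x
≈-sym x≈y i i∈S = sym (x≈y i i∈S)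

≈-trans : {S : Subset n} {x y z : Word m n} → x ≈[ S ] y → y ≈[ S ] z → x ≈[ S ] z
≈-trans x≈y y≈z i i∈S = trans (x≈y i i∈S) (y≈z i i∈S)

DependsOn : Subset n → Pred (Word m n) 0ℓ → Set
DependsOn S P = ∀ x y → x ≈[ S ] y → P x → P y

Disjoint : Subset n → Subset n → Set
Disjoint S R = ∀ {i} → i ∈ S → i ∈ R → ⊥

module _ {m n : ℕ} {s : Bool} {S : Subset n} {a b : Fin m} {x y : Word m n} where

  ≈-∷ : (s ≡ inside → a ≡ b) → x ≈[ S ] y → (a ∷ x) ≈[ s ∷ S ] (b ∷ y)
  ≈-∷ a≡b x≈y zero    here        = a≡b refl
  ≈-∷ a≡b x≈y (suc i) (there i∈S) = x≈y i i∈S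

  ≈-tail : (a ∷ x) ≈[ s ∷ S ] (b ∷ y) → x ≈[ S ] y
  ≈-tail x≈y i i∈S = x≈y (suc i) (there i∈S)

cell? : (S : Subset n) (z : Word m n) → Decidable (λ x → x ≈[ S ] z)
cell? S z x = x ≈?[ S ] z

∑-cell : (S : Subset n) (z : Word m n) →
         (∑[ x ← words m n ] χ (x ≈?[ S ] z)) * m ^ ∣ S ∣ ≡ m ^ n
∑-cell {m = m} [] [] = refl
∑-cell {suc n} {m} (outside ∷ S) (c ∷ z) = begin-equality
  (∑[ x ← words m (suc n) ] χ (x ≈?[ outside ∷ S ] (c ∷ z))) * M   ≡⟨ cong (_* M) (∑-words {m} {n} _) ⟩
  (∑[ a ← allFin m ] ∑[ x ← words m n ] χ ((a ∷ x) ≈?[ outside ∷ S ] (c ∷ z))) * M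
    ≡⟨ cong (_* M) (∑-cong (allFin m) (λ a → ∑-cong (words m n) (λ x →
         χ-cong ((a ∷ x) ≈?[ outside ∷ S ] (c ∷ z)) (x ≈?[ S ] z) ≈-tail (≈-∷ (λ ()))))) ⟩
  (∑[ _ ← allFin m ] ∑[ x ← words m n ] χ (x ≈?[ S ] z)) * M       ≡⟨ cong (_* M) (∑-const (allFin m) _) ⟩
  length (allFin m) * N * M                                         ≡⟨ cong (λ k → k * N * M) (length-allFin m) ⟩
  m * N * M                                                         ≡⟨ *-assoc m N M ⟩
  m * (N * M)                                                       ≡⟨ cong (m *_) (∑-cell S z) ⟩
  m * m ^ n                                                         ∎
  where
  open ≤-Reasoning
  M = m ^ ∣ S ∣
  N = ∑[ x ← words m n ] χ (x ≈?[ S ] z)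
∑-cell {suc n} {m} (inside ∷ S) (c ∷ z) = begin-equality
  (∑[ x ← words m (suc n) ] χ (x ≈?[ inside ∷ S ] (c ∷ z))) * (m * M)   ≡⟨ cong (_* (m * M)) (∑-words {m} {n} _) ⟩
  (∑[ a ← allFin m ] ∑[ x ← words m n ] χ ((a ∷ x) ≈?[ inside ∷ S ] (c ∷ z))) * (m * M)
    ≡⟨ cong (_* (m * M)) (∑-cong (allFin m) (λ a → trans (∑-cong (words m n) (λ x →
         trans (χ-cong ((a ∷ x) ≈?[ inside ∷ S ] (c ∷ z)) ((a ≟ c) ×-dec (x ≈?[ S ] z))
                  (λ h → h zero here , ≈-tail h) (λ { (a≡c , h) → ≈-∷ (λ _ → a≡c) h }))
               (χ-× (a ≟ c) (x ≈?[ S ] z)))) (∑-*ˡ (words m n) (χ (a ≟ c)) _))) ⟩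
  (∑[ a ← allFin m ] (χ (a ≟ c) * N)) * (m * M)                         ≡⟨ cong (_* (m * M)) (∑-*ʳ (allFin m) _ N) ⟩
  (∑[ a ← allFin m ] χ (a ≟ c)) * N * (m * M)                           ≡⟨ cong (λ k → k * N * (m * M)) (∑-≟ c) ⟩
  1 * N * (m * M)                                                        ≡⟨ shuffle N m M ⟩
  m * (N * M)                                                            ≡⟨ cong (m *_) (∑-cell S z) ⟩
  m * m ^ n                                                              ∎
  where
  open ≤-Reasoning
  M = m ^ ∣ S ∣
  N = ∑[ x ← words m n ] χ (x ≈?[ S ] z)
  shuffle : ∀ N m M → 1 * N * (m * M) ≡ m * (N * M)
  shuffle = solve-∀

card-cell : (S : Subset n) (z : Word m n) → card (cell? S z) * m ^ ∣ S ∣ ≡ m ^ n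
card-cell {m = m} S z = trans (cong (_* m ^ ∣ S ∣) (card-∑ (cell? S z))) (∑-cell S z)

card-within-cell : {P : Pred (Word m n) 0ℓ} (P? : Decidable P) (S : Subset n) →
                   (∀ {x y} → P x → P y → x ≈[ S ] y) → card P? * m ^ ∣ S ∣ ≤ m ^ n
card-within-cell {m} {n} P? S agree with card P? in eq
... | zero  = z≤n
... | suc k with z , Pz ← card-witness P? (subst (0 <_) (sym eq) z<s) = begin
  suc k * m ^ ∣ S ∣             ≡⟨ cong (_* m ^ ∣ S ∣) (sym eq) ⟩
  card P? * m ^ ∣ S ∣           ≤⟨ *-monoˡ-≤ (m ^ ∣ S ∣) (card-mono P? (cell? S z) (λ x Px → agree Px Pz)) ⟩
  card (cell? S z) * m ^ ∣ S ∣  ≡⟨ card-cell S z ⟩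
  m ^ n                         ∎
  where open ≤-Reasoning

-- Cells are indexed by all words z instead of representatives. Each word then lies in the cells of
-- exactly m^n / m^∣S∣ words z, and the factors on the two sides account for this multiplicity.
∑-card-cells : {P : Pred (Word m n) 0ℓ} (P? : Decidable P) (S : Subset n) →
  (∑[ z ← words m n ] card (λ x → P? x ×-dec cell? S z x)) * m ^ ∣ S ∣ ≡ card P? * m ^ n
∑-card-cells {m} {n} P? S = begin-equality
  (∑[ z ← words m n ] card (λ x → P? x ×-dec cell? S z x)) * M
    ≡⟨ cong (_* M) (∑-cong (words m n) (λ z → card-∑ (λ x → P? x ×-dec cell? S z x))) ⟩
  (∑[ z ← words m n ] ∑[ x ← words m n ] χ (P? x ×-dec cell? S z x)) * M
    ≡⟨ cong (_* M) (∑-swap (words m n) (words m n) _) ⟩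
  (∑[ x ← words m n ] ∑[ z ← words m n ] χ (P? x ×-dec cell? S z x)) * M
    ≡⟨ sym (∑-*ʳ (words m n) _ M) ⟩
  ∑[ x ← words m n ] ((∑[ z ← words m n ] χ (P? x ×-dec cell? S z x)) * M)
    ≡⟨ ∑-cong (words m n) inner ⟩
  ∑[ x ← words m n ] (χ (P? x) * m ^ n)
    ≡⟨ ∑-*ʳ (words m n) _ (m ^ n) ⟩
  (∑[ x ← words m n ] χ (P? x)) * m ^ n
    ≡⟨ cong (_* m ^ n) (sym (card-∑ P?)) ⟩
  card P? * m ^ n ∎
  where
  open ≤-Reasoning
  M = m ^ ∣ S ∣
  inner : ∀ x → (∑[ z ← words m n ] χ (P? x ×-dec cell? S z x)) * M ≡ χ (P? x) * m ^ n
  inner x = begin-equality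
    (∑[ z ← words m n ] χ (P? x ×-dec cell? S z x)) * M
      ≡⟨ cong (_* M) (∑-cong (words m n) (λ z → trans (χ-× (P? x) (cell? S z x))
           (cong (χ (P? x) *_) (χ-cong (cell? S z x) (z ≈?[ S ] x) (≈-sym {S = S} {x} {z}) (≈-sym {S = S} {z} {x}))))) ⟩
    (∑[ z ← words m n ] (χ (P? x) * χ (z ≈?[ S ] x))) * M
      ≡⟨ cong (_* M) (∑-*ˡ (words m n) (χ (P? x)) _) ⟩
    χ (P? x) * (∑[ z ← words m n ] χ (z ≈?[ S ] x)) * M
      ≡⟨ *-assoc (χ (P? x)) _ M ⟩
    χ (P? x) * ((∑[ z ← words m n ] χ (z ≈?[ S ] x)) * M)
      ≡⟨ cong (χ (P? x) *_) (∑-cell S x) ⟩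
    χ (P? x) * m ^ n ∎

-- Independence of disjoint coordinate sets

∑-*-const : ∀ {m} (F G : Fin m → ℕ) → (∀ a b → G a ≡ G b) →
            (∑[ a ← allFin m ] (F a * G a)) * m ≡ ∑ (allFin m) F * ∑ (allFin m) G
∑-*-const {m} F G const = begin-equality
  (∑[ a ← allFin m ] (F a * G a)) * m      ≡⟨ sym (∑-*ʳ (allFin m) _ m) ⟩
  ∑[ a ← allFin m ] (F a * G a * m)        ≡⟨ ∑-cong (allFin m) step ⟩
  ∑[ a ← allFin m ] (F a * ∑ (allFin m) G) ≡⟨ ∑-*ʳ (allFin m) F _ ⟩
  ∑ (allFin m) F * ∑ (allFin m) G          ∎
  where
  open ≤-Reasoning
  step : ∀ a → F a * G a * m ≡ F a * ∑ (allFin m) G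
  step a = trans (*-assoc (F a) (G a) m) (cong (F a *_) (begin-equality
    G a * m                    ≡⟨ *-comm (G a) m ⟩
    m * G a                    ≡⟨ cong (_* G a) (sym (length-allFin m)) ⟩
    length (allFin m) * G a    ≡⟨ sym (∑-const (allFin m) (G a)) ⟩
    ∑[ _ ← allFin m ] G a      ≡⟨ ∑-cong (allFin m) (λ b → const a b) ⟩
    ∑ (allFin m) G             ∎))

-- By induction on n: the head coordinate is missing from `U` or from `R`, so one of the two partial
-- sums does not depend on the head letter, and `∑-*-const` splits the sum over that letter.
∑-independent : (U R : Subset n) → Disjoint U R → (f g : Word m n → ℕ) →
  (∀ {x y} → x ≈[ U ] y → f x ≡ f y) → (∀ {x y} → x ≈[ R ] y → g x ≡ g y) →
  (∑[ x ← words m n ] (f x * g x)) * m ^ n ≡ ∑ (words m n) f * ∑ (words m n) g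
∑-independent [] [] disj f g df dg = base (f []) (g [])
  where
  base : ∀ a b → (a * b + 0) * 1 ≡ (a + 0) * (b + 0)
  base = solve-∀
∑-independent {suc n} {m} (u ∷ U) (r ∷ R) disj f g df dg = begin-equality
  (∑[ x ← words m (suc n) ] (f x * g x)) * (m * m ^ n)
    ≡⟨ cong (_* (m * m ^ n)) (∑-words {m} {n} _) ⟩
  (∑[ a ← allFin m ] H a) * (m * m ^ n)                    ≡⟨ shuffle (∑ (allFin m) H) m (m ^ n) ⟩
  (∑[ a ← allFin m ] H a) * m ^ n * m                      ≡⟨ cong (_* m) (sym (∑-*ʳ (allFin m) H (m ^ n))) ⟩
  (∑[ a ← allFin m ] (H a * m ^ n)) * m                    ≡⟨ cong (_* m) (∑-cong (allFin m) ih) ⟩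
  (∑[ a ← allFin m ] (F a * G a)) * m                      ≡⟨ heads u r disj df dg ⟩
  ∑ (allFin m) F * ∑ (allFin m) G                          ≡⟨ sym (cong₂ _*_ (∑-words {m} {n} f) (∑-words {m} {n} g)) ⟩
  ∑ (words m (suc n)) f * ∑ (words m (suc n)) g            ∎
  where
  open ≤-Reasoning
  H F G : Fin m → ℕ
  H a = ∑[ x ← words m n ] (f (a ∷ x) * g (a ∷ x))
  F a = ∑[ x ← words m n ] f (a ∷ x)
  G a = ∑[ x ← words m n ] g (a ∷ x)
  shuffle : ∀ a b c → a * (b * c) ≡ a * c * b
  shuffle = solve-∀
  ih : ∀ a → H a * m ^ n ≡ F a * G a
  ih a = ∑-independent U R (λ p q → disj (there p) (there q)) (λ x → f (a ∷ x)) (λ x → g (a ∷ x))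
           (λ e → df (≈-∷ (λ _ → refl) e)) (λ e → dg (≈-∷ (λ _ → refl) e))
  heads : ∀ u r → Disjoint (u ∷ U) (r ∷ R) →
          (∀ {x y} → x ≈[ u ∷ U ] y → f x ≡ f y) → (∀ {x y} → x ≈[ r ∷ R ] y → g x ≡ g y) →
          (∑[ a ← allFin m ] (F a * G a)) * m ≡ ∑ (allFin m) F * ∑ (allFin m) G
  heads inside inside disj _ _ = ⊥-elim (disj here here)
  heads _ outside _ _ dg = ∑-*-const F G (λ a b → ∑-cong (words m n) (λ x → dg (≈-∷ (λ ()) (λ _ _ → refl))))
  heads outside inside _ df _ = begin-equality
    (∑[ a ← allFin m ] (F a * G a)) * m  ≡⟨ cong (_* m) (∑-cong (allFin m) (λ a → *-comm (F a) (G a))) ⟩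
    (∑[ a ← allFin m ] (G a * F a)) * m
      ≡⟨ ∑-*-const G F (λ a b → ∑-cong (words m n) (λ x → df (≈-∷ (λ ()) (λ _ _ → refl)))) ⟩
    ∑ (allFin m) G * ∑ (allFin m) F      ≡⟨ *-comm (∑ (allFin m) G) _ ⟩
    ∑ (allFin m) F * ∑ (allFin m) G      ∎

card-independent : {P Q : Pred (Word m n) 0ℓ} (P? : Decidable P) (Q? : Decidable Q) (U R : Subset n) →
  Disjoint U R → DependsOn U P → DependsOn R Q →
  card (λ x → P? x ×-dec Q? x) * m ^ n ≡ card P? * card Q?
card-independent {m} {n} P? Q? U R disj dP dQ = begin-equality
  card (λ x → P? x ×-dec Q? x) * m ^ n
    ≡⟨ cong (_* m ^ n) (trans (card-∑ (λ x → P? x ×-dec Q? x)) (∑-cong (words m n) (λ x → χ-× (P? x) (Q? x)))) ⟩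
  (∑[ x ← words m n ] (χ (P? x) * χ (Q? x))) * m ^ n
    ≡⟨ ∑-independent U R disj (λ x → χ (P? x)) (λ x → χ (Q? x))
         (λ {x} {y} e → χ-cong (P? x) (P? y) (dP x y e) (dP y x (≈-sym {S = U} {x} {y} e)))
         (λ {x} {y} e → χ-cong (Q? x) (Q? y) (dQ x y e) (dQ y x (≈-sym {S = R} {x} {y} e))) ⟩
  (∑[ x ← words m n ] χ (P? x)) * (∑[ x ← words m n ] χ (Q? x))
    ≡⟨ sym (cong₂ _*_ (card-∑ P?) (card-∑ Q?)) ⟩
  card P? * card Q? ∎
  where open ≤-Reasoning

-- Sizes of subsets

subset-of-size : (X : Subset n) (r : ℕ) → r ≤ ∣ X ∣ → ∃[ R ] (∀ {i} → i ∈ R → i ∈ X) × ∣ R ∣ ≡ r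
subset-of-size {n} X zero _ = ∅ , (λ i∈ → ⊥-elim (∉⊥ i∈)) ,
                              ∣⊥∣≡0 n
subset-of-size (inside ∷ X) (suc r) (s≤s r≤) with R , R⊆X , ∣R∣ ← subset-of-size X r r≤ =
  inside ∷ R , (λ { here → here ; (there i∈) → there (R⊆X i∈) }) , cong suc ∣R∣
subset-of-size (outside ∷ X) (suc r) r≤ with R , R⊆X , ∣R∣ ← subset-of-size X (suc r) r≤ =
  outside ∷ R , (λ { (there i∈) → there (R⊆X i∈) }) , ∣R∣

subset-avoiding : (U : Subset n) (r : ℕ) → r + ∣ U ∣ ≤ n → ∃[ R ] Disjoint U R × ∣ R ∣ ≡ r
subset-avoiding {n} U r r+U≤n
  with R , R⊆ , ∣R∣ ← subset-of-size (∁ U) r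
         (≤-trans (m+n≤o⇒m≤o∸n r r+U≤n) (≤-reflexive (sym (∣∁p∣≡n∸∣p∣ U)))) =
  R , (λ i∈U i∈R → x∈∁p⇒x∉p (R⊆ i∈R) i∈U) , ∣R∣

∣p∪q∣≤∣p∣+∣q∣ : (S R : Subset n) → ∣ S ∪ R ∣ ≤ ∣ S ∣ + ∣ R ∣
∣p∪q∣≤∣p∣+∣q∣ []            []            = z≤n
∣p∪q∣≤∣p∣+∣q∣ (outside ∷ S) (outside ∷ R) = ∣p∪q∣≤∣p∣+∣q∣ S R
∣p∪q∣≤∣p∣+∣q∣ (outside ∷ S) (inside ∷ R)  = ≤-trans (s≤s (∣p∪q∣≤∣p∣+∣q∣ S R)) (≤-reflexive (sym (+-suc ∣ S ∣ ∣ R ∣)))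
∣p∪q∣≤∣p∣+∣q∣ (inside ∷ S)  (outside ∷ R) = s≤s (∣p∪q∣≤∣p∣+∣q∣ S R)
∣p∪q∣≤∣p∣+∣q∣ (inside ∷ S)  (inside ∷ R)  = s≤s (≤-trans (∣p∪q∣≤∣p∣+∣q∣ S R) (+-monoʳ-≤ ∣ S ∣ (n≤1+n ∣ R ∣)))

∣p∪q∣≡∣p∣+∣q∣ : (S R : Subset n) → Disjoint S R → ∣ S ∪ R ∣ ≡ ∣ S ∣ + ∣ R ∣
∣p∪q∣≡∣p∣+∣q∣ []            []            _    = refl
∣p∪q∣≡∣p∣+∣q∣ (s ∷ S) (r ∷ R) disj with ∣p∪q∣≡∣p∣+∣q∣ S R (λ p q → disj (there p) (there q))
∣p∪q∣≡∣p∣+∣q∣ (outside ∷ S) (outside ∷ R) disj | eq = eq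
∣p∪q∣≡∣p∣+∣q∣ (outside ∷ S) (inside ∷ R)  disj | eq = trans (cong suc eq) (sym (+-suc ∣ S ∣ ∣ R ∣))
∣p∪q∣≡∣p∣+∣q∣ (inside ∷ S)  (outside ∷ R) disj | eq = cong suc eq
∣p∪q∣≡∣p∣+∣q∣ (inside ∷ S)  (inside ∷ R)  disj | eq = ⊥-elim (disj here here)

∣p∪⁅i⁆∣ : (S : Subset n) (i : Fin n) → i ∉ S → ∣ S ∪ ⁅ i ⁆ ∣ ≡ suc ∣ S ∣
∣p∪⁅i⁆∣ S i i∉S = trans
  (∣p∪q∣≡∣p∣+∣q∣ S ⁅ i ⁆ (λ p q → i∉S (subst (_∈ S) (x∈⁅y⁆⇒x≡y i q) p)))
  (trans (cong (∣ S ∣ +_) (∣⁅x⁆∣≡1 i)) (+-comm ∣ S ∣ 1))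

∣∣-∑ : (Q : Subset n) → ∣ Q ∣ ≡ ∑[ i ← allFin n ] χ (i ∈? Q)
∣∣-∑ []      = refl
∣∣-∑ {suc n} (q ∷ Q) = sym (trans (∑-allFin-suc {n = n} (λ i → χ (i ∈? (q ∷ Q)))) (head q))
  where
  tail : ∀ q → ∑[ i ← allFin n ] χ (suc i ∈? (q ∷ Q)) ≡ ∣ Q ∣
  tail q = trans (∑-cong (allFin n) (λ i → χ-cong (suc i ∈? (q ∷ Q)) (i ∈? Q) (λ { (there p) → p }) there)) (sym (∣∣-∑ Q))
  head : ∀ q → χ (zero ∈? (q ∷ Q)) + (∑[ i ← allFin n ] χ (suc i ∈? (q ∷ Q))) ≡ ∣ q ∷ Q ∣
  head inside  = cong suc (tail inside)
  head outside = tail outside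

agreement-on : (x y : Word m n) (Q : Subset n) → x ≈[ Q ] y →
               (∀ i → i ∉ Q → lookup x i ≢ lookup y i) → agreement x y ≡ ∣ Q ∣
agreement-on {n = n} x y Q on off = begin-equality
  agreement x y                                   ≡⟨ length-filter-∑ (λ i → lookup x i ≟ lookup y i) (allFin n) ⟩
  ∑[ i ← allFin n ] χ (lookup x i ≟ lookup y i)   ≡⟨ ∑-cong (allFin n) (λ i →
      χ-cong (lookup x i ≟ lookup y i) (i ∈? Q) (λ e → decidable-stable (i ∈? Q) (λ i∉Q → off i i∉Q e)) (on i)) ⟩
  ∑[ i ← allFin n ] χ (i ∈? Q)                    ≡⟨ sym (∣∣-∑ Q) ⟩
  ∣ Q ∣                                           ∎
  where open ≤-Reasoning

-- Popular coordinates

m≤n+p⇒2p≤m⇒m≤2n : ∀ a b p → a ≤ b + p → 2 * p ≤ a → a ≤ 2 * b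
m≤n+p⇒2p≤m⇒m≤2n a b p a≤b+p 2p≤a = +-cancelʳ-≤ a a (2 * b) (begin
  a + a           ≤⟨ +-mono-≤ a≤b+p a≤b+p ⟩
  b + p + (b + p) ≡⟨ eq b p ⟩
  2 * b + 2 * p   ≤⟨ +-monoʳ-≤ (2 * b) 2p≤a ⟩
  2 * b + a       ∎)
  where
  open ≤-Reasoning
  eq : ∀ b p → b + p + (b + p) ≡ 2 * b + 2 * p
  eq = solve-∀

-- A pigeonhole principle. The positivity of the chosen term matters too: when the terms are
-- cardinalities, it supplies a member of the chosen set.
∑-max : (xs : List X) (f : X → ℕ) → 0 < ∑ xs f → ∃[ x ] 0 < f x × ∑ xs f ≤ length xs * f x
∑-max (x ∷ xs) f 0<∑ with ∑ xs f in eq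
... | zero  = x , subst (0 <_) (+-identityʳ (f x)) 0<∑ , +-monoʳ-≤ (f x) z≤n
... | suc k with ∑-max xs f (subst (0 <_) (sym eq) z<s)
...   | y , 0<fy , ∑≤ with ≤-total (f x) (f y)
...     | inj₁ fx≤fy = y , 0<fy , +-mono-≤ fx≤fy (subst (_≤ length xs * f y) eq ∑≤)
...     | inj₂ fy≤fx = x , ≤-trans 0<fy fy≤fx ,
                       +-monoʳ-≤ (f x) (≤-trans (subst (_≤ length xs * f y) eq ∑≤) (*-monoʳ-≤ (length xs) fy≤fx))

∑-card-coordinate : {P : Pred (Word m n) 0ℓ} (P? : Decidable P) (i : Fin n) →
  ∑[ u ← allFin m ] card (λ x → P? x ×-dec (lookup x i ≟ u)) ≡ card P?
∑-card-coordinate {m} {n} P? i = begin-equality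
  ∑[ u ← allFin m ] card (λ x → P? x ×-dec (lookup x i ≟ u))
    ≡⟨ ∑-cong (allFin m) (λ u → card-∑ (λ x → P? x ×-dec (lookup x i ≟ u))) ⟩
  ∑[ u ← allFin m ] ∑[ x ← words m n ] χ (P? x ×-dec (lookup x i ≟ u))
    ≡⟨ ∑-swap (allFin m) (words m n) _ ⟩
  ∑[ x ← words m n ] ∑[ u ← allFin m ] χ (P? x ×-dec (lookup x i ≟ u))
    ≡⟨ ∑-cong (words m n) inner ⟩
  ∑[ x ← words m n ] χ (P? x)
    ≡⟨ sym (card-∑ P?) ⟩
  card P? ∎
  where
  open ≤-Reasoning
  inner : ∀ x → ∑[ u ← allFin m ] χ (P? x ×-dec (lookup x i ≟ u)) ≡ χ (P? x)
  inner x = begin-equality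
    ∑[ u ← allFin m ] χ (P? x ×-dec (lookup x i ≟ u))
      ≡⟨ ∑-cong (allFin m) (λ u → trans (χ-× (P? x) (lookup x i ≟ u))
           (cong (χ (P? x) *_) (χ-cong (lookup x i ≟ u) (u ≟ lookup x i) sym sym))) ⟩
    ∑[ u ← allFin m ] (χ (P? x) * χ (u ≟ lookup x i))
      ≡⟨ ∑-*ˡ (allFin m) (χ (P? x)) _ ⟩
    χ (P? x) * (∑[ u ← allFin m ] χ (u ≟ lookup x i))
      ≡⟨ cong (χ (P? x) *_) (∑-≟ (lookup x i)) ⟩
    χ (P? x) * 1
      ≡⟨ *-identityʳ _ ⟩
    χ (P? x) ∎

-- The coordinates outside R are taken from w, so that the result is determined
-- by the restriction of z to R.
mask : Subset n → Word m n → Word m n → Word m n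
mask []            []      []      = []
mask (inside ∷ R)  (_ ∷ w) (a ∷ z) = a ∷ mask R w z
mask (outside ∷ R) (b ∷ w) (_ ∷ z) = b ∷ mask R w z

mask-≈ : (R : Subset n) (w z : Word m n) → mask R w z ≈[ R ] z
mask-≈ (inside ∷ R)  (_ ∷ w) (a ∷ z) = ≈-∷ (λ _ → refl) (mask-≈ R w z)
mask-≈ (outside ∷ R) (b ∷ w) (_ ∷ z) = ≈-∷ (λ ()) (mask-≈ R w z)

mask-cong : (R : Subset n) (w : Word m n) {z z′ : Word m n} → z ≈[ R ] z′ → mask R w z ≡ mask R w z′
mask-cong []            []      {[]}    {[]}     e = refl
mask-cong (inside ∷ R)  (_ ∷ w) {_ ∷ _} {_ ∷ _} e = cong₂ _∷_ (e zero here) (mask-cong R w (≈-tail e))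
mask-cong (outside ∷ R) (b ∷ w) {_ ∷ _} {_ ∷ _} e = cong (b ∷_) (mask-cong R w (≈-tail e))

module _ {m n : ℕ} .{{_ : NonZero m}} where

  private
    T : ℕ
    T = m ^ n

    instance
      T≢0 : NonZero T
      T≢0 = m^n≢0 m n

  module _ (v : Word m n → Fin m) (R : Subset n) (v-dep : ∀ {x y} → x ≈[ R ] y → v x ≡ v y) where

    weight : Fin m → ℕ
    weight u = card (λ z → v z ≟ u)

    ∑-weight : ∑ (allFin m) weight ≡ T
    ∑-weight = begin-equality
      ∑ (allFin m) weight
        ≡⟨ ∑-cong (allFin m) (λ u → card-∑ (λ z → v z ≟ u)) ⟩
      ∑[ u ← allFin m ] ∑[ z ← words m n ] χ (v z ≟ u)
        ≡⟨ ∑-swap (allFin m) (words m n) _ ⟩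
      ∑[ z ← words m n ] ∑[ u ← allFin m ] χ (v z ≟ u)
        ≡⟨ ∑-cong (words m n) (λ z → trans (∑-cong (allFin m) (λ u → χ-cong (v z ≟ u) (u ≟ v z) sym sym)) (∑-≟ (v z))) ⟩
      ∑[ _ ← words m n ] 1
        ≡⟨ trans (∑-const (words m n) 1) (trans (*-identityʳ _) (length-words m n)) ⟩
      T ∎
      where open ≤-Reasoning

    -- The weights sum to `T`, so at most h values have weight T/h or more, and by hypothesis each
    -- of them is taken at i by at most a/G words of P.
    card-heavy-values : (i : Fin n) (h G a : ℕ) {P : Pred (Word m n) 0ℓ} (P? : Decidable P) →
      (∀ u → G * card (λ x → P? x ×-dec (lookup x i ≟ u)) ≤ a) →
      G * card (λ x → P? x ×-dec (T ≤? weight (lookup x i) * h)) ≤ h * a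
    card-heavy-values i h G a P? spread = begin
      G * card (λ x → P? x ×-dec (T ≤? weight (lookup x i) * h))
        ≤⟨ *-monoʳ-≤ G (card-⋃ (λ x → P? x ×-dec (T ≤? weight (lookup x i) * h)) (allFin m)
             (λ u x → (P? x ×-dec (lookup x i ≟ u)) ×-dec (T ≤? weight u * h))
             (λ { x (p , q) → lookup x i , ∈-allFin (lookup x i) , (p , refl) , q })) ⟩
      G * (∑[ u ← allFin m ] card (λ x → (P? x ×-dec (lookup x i ≟ u)) ×-dec (T ≤? weight u * h)))
        ≡⟨ sym (∑-*ˡ (allFin m) G _) ⟩
      ∑[ u ← allFin m ] (G * card (λ x → (P? x ×-dec (lookup x i ≟ u)) ×-dec (T ≤? weight u * h)))
        ≤⟨ ∑-mono (allFin m) value ⟩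
      ∑[ u ← allFin m ] (χ (T ≤? weight u * h) * a)
        ≡⟨ ∑-*ʳ (allFin m) _ a ⟩
      (∑[ u ← allFin m ] χ (T ≤? weight u * h)) * a
        ≤⟨ *-monoˡ-≤ a few ⟩
      h * a ∎
      where
      open ≤-Reasoning
      value : ∀ u → G * card (λ x → (P? x ×-dec (lookup x i ≟ u)) ×-dec (T ≤? weight u * h))
                  ≤ χ (T ≤? weight u * h) * a
      value u = bound (T ≤? weight u * h)
        where
        bound : (d : Dec (T ≤ weight u * h)) →
                G * card (λ x → (P? x ×-dec (lookup x i ≟ u)) ×-dec d) ≤ χ d * a
        bound d@(yes _) = ≤-trans (*-monoʳ-≤ G (card-mono (λ x → (P? x ×-dec (lookup x i ≟ u)) ×-dec d)
                                    (λ x → P? x ×-dec (lookup x i ≟ u)) (λ _ → proj₁)))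
                            (≤-trans (spread u) (≤-reflexive (sym (*-identityˡ a))))
        bound d@(no T≰) = ≤-reflexive (trans (cong (G *_) (card-empty
                            (λ x → (P? x ×-dec (lookup x i ≟ u)) ×-dec d) (λ { _ (_ , l) → T≰ l }))) (*-zeroʳ G))
      few : ∑[ u ← allFin m ] χ (T ≤? weight u * h) ≤ h
      few = *-cancelʳ-≤ _ h T (begin
        (∑[ u ← allFin m ] χ (T ≤? weight u * h)) * T  ≡⟨ sym (∑-*ʳ (allFin m) _ T) ⟩
        ∑[ u ← allFin m ] (χ (T ≤? weight u * h) * T)  ≤⟨ ∑-mono (allFin m) (λ u →
             ≤-trans (χ-* (T ≤? weight u * h) id)
               (≤-trans (*-monoˡ-≤ (weight u * h) (χ≤1 (T ≤? weight u * h))) (≤-reflexive (*-identityˡ _)))) ⟩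
        ∑[ u ← allFin m ] (weight u * h)               ≡⟨ ∑-*ʳ (allFin m) weight h ⟩
        ∑ (allFin m) weight * h                        ≡⟨ cong (_* h) ∑-weight ⟩
        T * h                                          ≡⟨ *-comm T h ⟩
        h * T                                          ∎)

    -- For a fixed value u, the event E together with `lookup x i ≡ u` involves only `U ∪ ⁅ i ⁆`,
    -- which is disjoint from `R`. It is thus independent of `v x ≡ u`, an event of probability at
    -- most 1/h when u is light. All randomness comes from `R`, so i may be a coordinate that E
    -- already involves.
    card-light-values : (i : Fin n) → i ∉ R → (h : ℕ) (U : Subset n) → Disjoint U R →
      {E : Pred (Word m n) 0ℓ} (E? : Decidable E) → DependsOn U E →
      card (λ x → E? x ×-dec ((lookup x i ≟ v x) ×-dec (weight (lookup x i) * h ≤? T))) * h ≤ card E?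
    card-light-values i i∉R h U disj {E} E? dE = begin
      card C? * h                                   ≤⟨ *-monoˡ-≤ h (card-⋃ C? (allFin m) D? (λ { x (e , eq , l) →
                                                         lookup x i , ∈-allFin (lookup x i) , ((e , refl) , sym eq) , l })) ⟩
      (∑[ u ← allFin m ] card (D? u)) * h           ≡⟨ sym (∑-*ʳ (allFin m) _ h) ⟩
      ∑[ u ← allFin m ] (card (D? u) * h)           ≤⟨ ∑-mono (allFin m) value ⟩
      ∑[ u ← allFin m ] card (Eᵤ? u)                ≡⟨ ∑-card-coordinate E? i ⟩
      card E?                                       ∎
      where
      open ≤-Reasoning
      C? = λ x → E? x ×-dec ((lookup x i ≟ v x) ×-dec (weight (lookup x i) * h ≤? T))
      Eᵤ? = λ u x → E? x ×-dec (lookup x i ≟ u)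
      D? = λ u x → (Eᵤ? u x ×-dec (v x ≟ u)) ×-dec (weight u * h ≤? T)
      Ui = U ∪ ⁅ i ⁆
      Ui-disj : Disjoint Ui R
      Ui-disj j∈Ui j∈R with x∈p∪q⁻ U ⁅ i ⁆ j∈Ui
      ... | inj₁ j∈U = disj j∈U j∈R
      ... | inj₂ j∈i = i∉R (subst (_∈ R) (x∈⁅y⁆⇒x≡y i j∈i) j∈R)
      dEᵤ : ∀ u → DependsOn Ui (λ x → E x × lookup x i ≡ u)
      dEᵤ u x y x≈y (e , eq) = dE x y (λ j j∈U → x≈y j (x∈p∪q⁺ (inj₁ j∈U))) e ,
                           trans (sym (x≈y i (x∈p∪q⁺ (inj₂ (x∈⁅x⁆ i))))) eq
      value : ∀ u → card (D? u) * h ≤ card (Eᵤ? u)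
      value u = bound (weight u * h ≤? T)
        where
        N = card (λ x → Eᵤ? u x ×-dec (v x ≟ u))
        rot : ∀ a b c → a * b * c ≡ a * c * b
        rot = solve-∀
        bound : (d : Dec (weight u * h ≤ T)) →
                card (λ x → (Eᵤ? u x ×-dec (v x ≟ u)) ×-dec d) * h ≤ card (Eᵤ? u)
        bound d@(no ¬l)  = ≤-trans (≤-reflexive (cong (_* h) (card-empty
                             (λ x → (Eᵤ? u x ×-dec (v x ≟ u)) ×-dec d) (λ { _ (_ , l) → ¬l l })))) z≤n
        bound d@(yes l) = *-cancelʳ-≤ _ (card (Eᵤ? u)) T (begin
          card (λ x → (Eᵤ? u x ×-dec (v x ≟ u)) ×-dec d) * h * T
            ≤⟨ *-monoˡ-≤ T (*-monoˡ-≤ h (card-mono (λ x → (Eᵤ? u x ×-dec (v x ≟ u)) ×-dec d)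
                 (λ x → Eᵤ? u x ×-dec (v x ≟ u)) (λ _ → proj₁))) ⟩
          N * h * T                     ≡⟨ rot N h T ⟩
          N * T * h                     ≡⟨ cong (_* h) (card-independent (Eᵤ? u) (λ x → v x ≟ u) Ui R Ui-disj (dEᵤ u)
                                            (λ x y x≈y eq → trans (sym (v-dep x≈y)) eq)) ⟩
          card (Eᵤ? u) * weight u * h   ≡⟨ *-assoc (card (Eᵤ? u)) _ h ⟩
          card (Eᵤ? u) * (weight u * h) ≤⟨ *-monoʳ-≤ (card (Eᵤ? u)) l ⟩
          card (Eᵤ? u) * T              ∎)

  module Spread
    (t k h : ℕ) .{{_ : NonZero h}} (room : suc t * (2 + k) ≤ n) {A₀ : Pred (Word m n) 0ℓ} (A₀? : Decidable A₀)
    (avoiding : Avoiding t A₀) (S : Subset n) (∣S∣≤t : ∣ S ∣ ≤ t) (agree : ∀ {x y} → A₀ x → A₀ y → x ≈[ S ] y)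
    (nonempty : 0 < card A₀?)
    (spread : ∀ i u → i ∉ S →
       h * (2 * n) ^ k * card (λ x → A₀? x ×-dec (lookup x i ≟ u)) ≤ card A₀?)
    where

    -- E is the event that the equations collected from the first j blocks hold;
    -- U contains all coordinates that they involve.
    record Stage (j : ℕ) : Set₁ where
      field
        {A E}   : Pred (Word m n) 0ℓ
        A?      : Decidable A
        E?      : Decidable E
        U       : Subset n
        S⊆U     : S ⊆ U
        A⊆A₀    : ∀ {x} → A x → A₀ x
        A⊆E     : ∀ {x} → A x → E x
        E-dep   : DependsOn U E
        ∣U∣≤    : ∣ U ∣ ≤ suc t * suc j
        card-E  : card E? * h ^ j ≤ T
        card-A  : card A₀? ≤ (2 * n) ^ j * card A?

    private
      0<n : 0 < n
      0<n = ≤-trans (s≤s z≤n) room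

      instance
        n≢0 : NonZero n
        n≢0 = >-nonZero 0<n
        2n≢0 : NonZero (2 * n)
        2n≢0 = m*n≢0 2 n

    start : Stage 0
    start = record
      { A? = A₀? ; E? = λ _ → yes refl ; U = S ; S⊆U = id ; A⊆A₀ = id ; A⊆E = λ _ → refl {x = 0}
      ; E-dep = λ _ _ _ e → e ; ∣U∣≤ = ≤-trans ∣S∣≤t (≤-trans (n≤1+n t) (≤-reflexive (sym (*-identityʳ (suc t)))))
      ; card-E = ≤-trans (≤-reflexive (*-identityʳ _)) (card≤m^n {m} {n} (λ _ → yes (refl {x = 0})))
      ; card-A = ≤-reflexive (sym (+-identityʳ (card A₀?))) }

    next : ∀ {j} → j < k → Stage j → Stage (suc j)
    next {j} j<k st = record
      { A? = A″? ; E? = E″? ; U = U ∪ (R ∪ ⁅ i ⁆)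
      ; S⊆U = λ p → x∈p∪q⁺ (inj₁ (S⊆U p))
      ; A⊆A₀ = λ { ((a , _) , _) → A⊆A₀ a }
      ; A⊆E = λ { ((a , _ , eq) , l) → A⊆E a , eq , l }
      ; E-dep = λ { x y x≈y (e , eq , l) →
          let xi≡yi = x≈y i (x∈p∪q⁺ (inj₂ (x∈p∪q⁺ (inj₂ (x∈⁅x⁆ i))))) in
          E-dep x y (λ c c∈U → x≈y c (x∈p∪q⁺ (inj₁ c∈U))) e ,
          trans (sym xi≡yi) (trans eq (v-dep i (λ c c∈R → x≈y c (x∈p∪q⁺ (inj₂ (x∈p∪q⁺ (inj₁ c∈R))))))) ,
          subst (λ u → weightᵢ u * h ≤ T) xi≡yi l }
      ; ∣U∣≤ = U-bound
      ; card-E = ≤-trans (≤-reflexive (sym (*-assoc (card E″?) h (h ^ j))))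
          (≤-trans (*-monoˡ-≤ (h ^ j) (card-light-values (v i) R (v-dep i) i (proj₁ split-i∉Q) h U
                       U∩R E? E-dep)) card-E)
      ; card-A = A-bound }
      where
      open Stage st
      open ≤-Reasoning
      -- This size makes `S ∪ R` have exactly t elements. Two words of A with the same restriction
      -- to `R` agree there, so avoidance forces a further agreement.
      r = t ∸ ∣ S ∣
      r≤t : r ≤ t
      r≤t = m∸n≤m t ∣ S ∣
      r+U≤n : r + ∣ U ∣ ≤ n
      r+U≤n = begin
        r + ∣ U ∣               ≤⟨ +-mono-≤ (≤-trans r≤t (n≤1+n t)) ∣U∣≤ ⟩
        suc t + suc t * suc j   ≡⟨ sym (*-suc (suc t) (suc j)) ⟩
        suc t * (2 + j)         ≤⟨ *-monoʳ-≤ (suc t) (s≤s (s≤s (<⇒≤ j<k))) ⟩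
        suc t * (2 + k)         ≤⟨ room ⟩
        n                       ∎
      block = subset-avoiding U r r+U≤n
      R = proj₁ block
      U∩R : Disjoint U R
      U∩R = proj₁ (proj₂ block)
      ∣R∣≡r = proj₂ (proj₂ block)
      Q = S ∪ R
      ∣Q∣≡t : ∣ Q ∣ ≡ t
      ∣Q∣≡t = trans (∣p∪q∣≡∣p∣+∣q∣ S R (λ p q → U∩R (S⊆U p) q))
                    (trans (cong (∣ S ∣ +_) ∣R∣≡r) (m+[n∸m]≡n ∣S∣≤t))

      A-nonempty : 0 < card A?
      A-nonempty = *-cancelˡ-< ((2 * n) ^ j) 0 (card A?)
        (<-≤-trans (≤-<-trans (≤-reflexive (*-zeroʳ ((2 * n) ^ j))) nonempty) card-A)

      w : Word m n
      w = proj₁ (card-witness A? A-nonempty)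
      matching? : ∀ p y → Dec (A y × y ≈[ R ] p)
      matching? p y = A? y ×-dec (y ≈?[ R ] p)
      -- The choice is a function of the masked word alone, which makes `v` depend only on the
      -- restriction to `R`. The default p for an empty set of candidates never arises from a word
      -- of A, by `rep-spec`.
      representative : (p : Word m n) → Dec (0 < card (matching? p)) → Word m n
      representative p (yes 0<c) = proj₁ (card-witness (matching? p) 0<c)
      representative p (no _)    = p
      rep : Word m n → Word m n
      rep x = representative (mask R w x) (0 <? card (matching? (mask R w x)))
      rep-spec : ∀ {x} → A x → A (rep x) × rep x ≈[ R ] x
      rep-spec {x} Ax = found (0 <? card (matching? (mask R w x)))
        where
        found : (d : Dec (0 < card (matching? (mask R w x)))) →
                A (representative (mask R w x) d) × representative (mask R w x) d ≈[ R ] x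
        found (yes 0<c) = let y , Ay , y≈ = card-witness (matching? (mask R w x)) 0<c in
          Ay , ≈-trans {S = R} {y} {mask R w x} {x} y≈ (mask-≈ R w x)
        found (no ¬0<c) = contradiction (card-pos (matching? (mask R w x))
          (Ax , ≈-sym {S = R} {mask R w x} {x} (mask-≈ R w x))) ¬0<c

      v : Fin n → Word m n → Fin m
      v i x = lookup (rep x) i
      v-dep : ∀ i {x y} → x ≈[ R ] y → v i x ≡ v i y
      v-dep i x≈y = cong (λ p → lookup (representative p (0 <? card (matching? p))) i) (mask-cong R w x≈y)

      A′? : ∀ i x → Dec (A x × i ∉ Q × lookup x i ≡ v i x)
      A′? i x = A? x ×-dec (¬? (i ∈? Q) ×-dec (lookup x i ≟ v i x))
      covered : ∀ x → A x → ∃[ i ] (i ∈ˡ allFin n) × A x × i ∉ Q × lookup x i ≡ v i x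
      covered x Ax = search (any? (λ i → ¬? (i ∈? Q) ×-dec (lookup x i ≟ v i x)))
        where
        onQ : x ≈[ Q ] rep x
        onQ c c∈Q = [ (λ c∈S → agree {x} {rep x} (A⊆A₀ Ax) (A⊆A₀ (proj₁ (rep-spec Ax))) c c∈S)
                    , (λ c∈R → sym (proj₂ (rep-spec {x} Ax) c c∈R)) ]′ (x∈p∪q⁻ S R c∈Q)
        search : Dec (∃[ i ] i ∉ Q × lookup x i ≡ v i x) → ∃[ i ] (i ∈ˡ allFin n) × A x × i ∉ Q × lookup x i ≡ v i x
        search (yes (i , i∉Q , eq)) = i , ∈-allFin i , Ax , i∉Q , eq
        -- Without an agreement off `Q` the two words would agree in exactly t places. A word that
        -- is its own representative causes no trouble: it satisfies the equation at every
        -- coordinate off `Q`.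
        search (no none) = ⊥-elim (avoiding x (rep x) (A⊆A₀ Ax) (A⊆A₀ (proj₁ (rep-spec Ax)))
          (trans (agreement-on x (rep x) Q onQ (λ i i∉Q eq → none (i , i∉Q , eq))) ∣Q∣≡t))
      covering : card A? ≤ ∑[ i ← allFin n ] card (A′? i)
      covering = card-⋃ A? (allFin n) A′? covered
      best = ∑-max (allFin n) (λ i → card (A′? i)) (≤-trans A-nonempty covering)
      i = proj₁ best
      split-i∉Q : i ∉ R × i ∉ S
      split-i∉Q = (λ p → i∉Q (x∈p∪q⁺ (inj₂ p))) , (λ p → i∉Q (x∈p∪q⁺ (inj₁ p)))
        where
        i∉Q : i ∉ Q
        i∉Q = proj₁ (proj₂ (proj₂ (card-witness (A′? i) (proj₁ (proj₂ best)))))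
      A≤nA′ : card A? ≤ n * card (A′? i)
      A≤nA′ = ≤-trans covering (≤-trans (proj₂ (proj₂ best)) (≤-reflexive (cong (_* card (A′? i)) (length-allFin n))))

      weightᵢ = weight (v i) R (v-dep i)
      A″? = λ x → A′? i x ×-dec (weightᵢ (lookup x i) * h ≤? T)
      E″? = λ x → E? x ×-dec ((lookup x i ≟ v i x) ×-dec (weightᵢ (lookup x i) * h ≤? T))
      heavy? = λ x → A₀? x ×-dec (T ≤? weightᵢ (lookup x i) * h)

      light-or-heavy : card (A′? i) ≤ card A″? + card heavy?
      light-or-heavy = card-∪ (A′? i) A″? heavy? side
        where
        side : ∀ x → A x × i ∉ Q × lookup x i ≡ v i x →
               ((A x × i ∉ Q × lookup x i ≡ v i x) × weightᵢ (lookup x i) * h ≤ T) ⊎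
               (A₀ x × T ≤ weightᵢ (lookup x i) * h)
        side x a′ = [ (λ l → inj₁ (a′ , l)) , (λ l → inj₂ (A⊆A₀ (proj₁ a′) , l)) ]′
                      (≤-total (weightᵢ (lookup x i) * h) T)

      -- Words with a heavy value at i form at most 1/(2n)^k of A₀, whereas `A′? i` keeps at least
      -- 1/((2n)^j n) of it. As j < k, the 2 in `2 * n` leaves room for the factor two.
      few-heavy : 2 * card heavy? ≤ card (A′? i)
      few-heavy = *-cancelˡ-≤ ((2 * n) ^ j * n) {{m*n≢0 _ n {{m^n≢0 (2 * n) j}}}} (*-cancelˡ-≤ h (begin
        h * ((2 * n) ^ j * n * (2 * card heavy?))     ≡⟨ eq₁ h ((2 * n) ^ j) n (card heavy?) ⟩
        h * (2 * n * (2 * n) ^ j) * card heavy?       ≤⟨ *-monoˡ-≤ (card heavy?) (*-monoʳ-≤ h (^-monoʳ-≤ (2 * n) j<k)) ⟩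
        h * (2 * n) ^ k * card heavy?
          ≤⟨ card-heavy-values (v i) R (v-dep i) i h (h * (2 * n) ^ k) (card A₀?) A₀? (λ u → spread i u (proj₂ split-i∉Q)) ⟩
        h * card A₀?                                  ≤⟨ *-monoʳ-≤ h card-A ⟩
        h * ((2 * n) ^ j * card A?)                   ≤⟨ *-monoʳ-≤ h (*-monoʳ-≤ ((2 * n) ^ j) A≤nA′) ⟩
        h * ((2 * n) ^ j * (n * card (A′? i)))        ≡⟨ cong (h *_) (sym (*-assoc ((2 * n) ^ j) n _)) ⟩
        h * ((2 * n) ^ j * n * card (A′? i))          ∎))
        where
        eq₁ : ∀ h q n c → h * (q * n * (2 * c)) ≡ h * (2 * n * q) * c
        eq₁ = solve-∀

      A-bound : card A₀? ≤ (2 * n) ^ suc j * card A″?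
      A-bound = begin
        card A₀?                                ≤⟨ card-A ⟩
        (2 * n) ^ j * card A?                   ≤⟨ *-monoʳ-≤ ((2 * n) ^ j) A≤nA′ ⟩
        (2 * n) ^ j * (n * card (A′? i))
          ≤⟨ *-monoʳ-≤ ((2 * n) ^ j) (*-monoʳ-≤ n (m≤n+p⇒2p≤m⇒m≤2n (card (A′? i)) (card A″?) _ light-or-heavy few-heavy)) ⟩
        (2 * n) ^ j * (n * (2 * card A″?))      ≡⟨ eq₂ ((2 * n) ^ j) n (card A″?) ⟩
        (2 * n) ^ suc j * card A″?              ∎
        where
        eq₂ : ∀ q n c → q * (n * (2 * c)) ≡ 2 * n * q * c
        eq₂ = solve-∀

      U-bound : ∣ U ∪ (R ∪ ⁅ i ⁆) ∣ ≤ suc t * suc (suc j)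
      U-bound = begin
        ∣ U ∪ (R ∪ ⁅ i ⁆) ∣        ≤⟨ ∣p∪q∣≤∣p∣+∣q∣ U _ ⟩
        ∣ U ∣ + ∣ R ∪ ⁅ i ⁆ ∣      ≡⟨ cong (∣ U ∣ +_) (trans (∣p∪⁅i⁆∣ R i (proj₁ split-i∉Q)) (cong suc ∣R∣≡r)) ⟩
        ∣ U ∣ + suc r              ≤⟨ +-mono-≤ ∣U∣≤ (s≤s r≤t) ⟩
        suc t * suc j + suc t      ≡⟨ trans (+-comm _ (suc t)) (sym (*-suc (suc t) (suc j))) ⟩
        suc t * suc (suc j)        ∎

    stage : ∀ j → j ≤ k → Stage j
    stage zero    _   = start
    stage (suc j) j<k = next j<k (stage j (<⇒≤ j<k))

    spread⇒small : card A₀? * h ^ k ≤ (2 * n) ^ k * T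
    spread⇒small = begin
      card A₀? * h ^ k                  ≤⟨ *-monoˡ-≤ (h ^ k) card-A ⟩
      (2 * n) ^ k * card A? * h ^ k     ≤⟨ *-monoˡ-≤ (h ^ k) (*-monoʳ-≤ ((2 * n) ^ k) (card-mono A? E? (λ _ → A⊆E))) ⟩
      (2 * n) ^ k * card E? * h ^ k     ≡⟨ *-assoc ((2 * n) ^ k) _ _ ⟩
      (2 * n) ^ k * (card E? * h ^ k)   ≤⟨ *-monoʳ-≤ ((2 * n) ^ k) card-E ⟩
      (2 * n) ^ k * T                   ∎
      where
      open Stage (stage k ≤-refl)
      open ≤-Reasoning

update-≈ : (S : Subset n) (i : Fin n) (z : Word m n) {x : Word m n} {u : Fin m} → i ∉ S →
           x ≈[ S ] z → lookup x i ≡ u → x ≈[ S ∪ ⁅ i ⁆ ] (z [ i ]≔ u)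
update-≈ S i z {x} {u} i∉S x≈z xi≡u c c∈ with x∈p∪q⁻ S ⁅ i ⁆ c∈
... | inj₁ c∈S = trans (x≈z c c∈S)
                       (sym (lookup∘update′ (λ c≡i → i∉S (subst (_∈ S) c≡i c∈S)) z u))
... | inj₂ c∈i rewrite x∈⁅y⁆⇒x≡y i c∈i = trans xi≡u (sym (lookup∘update i z u))

module _ {m n : ℕ} .{{_ : NonZero m}} where

  private
    T : ℕ
    T = m ^ n

    instance
      T≢0 : NonZero T
      T≢0 = m^n≢0 m n

  popular-coordinate : (t k h : ℕ) .{{_ : NonZero h}} → suc t * (2 + k) ≤ n →
    {A : Pred (Word m n) 0ℓ} (A? : Decidable A) → Avoiding t A →
    (S : Subset n) → ∣ S ∣ ≤ t → (∀ {x y} → A x → A y → x ≈[ S ] y) →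
    (2 * n) ^ k * T < card A? * h ^ k →
    ∃[ i ] ∃[ u ] i ∉ S × card A? ≤ h * (2 * n) ^ k * card (λ x → A? x ×-dec (lookup x i ≟ u))
  popular-coordinate t k h room A? avoiding S ∣S∣≤t agree large =
    decide (any? (λ i → any? (λ u → ¬? (i ∈? S) ×-dec (card A? ≤? concentration i u))))
    where
    concentration : Fin n → Fin m → ℕ
    concentration i u = h * (2 * n) ^ k * card (λ x → A? x ×-dec (lookup x i ≟ u))
    decide : Dec (∃[ i ] ∃[ u ] i ∉ S × card A? ≤ concentration i u) → ∃[ i ] ∃[ u ] i ∉ S × card A? ≤ concentration i u
    decide (yes found) = found
    decide (no none)   = contradiction
      (Spread.spread⇒small t k h room A? avoiding S ∣S∣≤t agree
        (*-cancelʳ-< (h ^ k) 0 (card A?) (≤-<-trans z≤n large))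
        (λ i u i∉S → ≰⇒≥ (λ pop → none (i , u , i∉S , pop))))
      (<⇒≱ large)

  -- Each new coordinate costs a factor G. The G^(t+1) in the hypothesis keeps every intermediate
  -- set above the threshold of `popular-coordinate`; avoidance passes to subsets.
  popular-cell : (t k h : ℕ) .{{_ : NonZero h}} → suc t * (2 + k) ≤ n →
    {A : Pred (Word m n) 0ℓ} (A? : Decidable A) → Avoiding t A →
    (h * (2 * n) ^ k) ^ suc t * ((2 * n) ^ k * T) < card A? * h ^ k →
    ∀ s → s ≤ suc t → ∃[ S ] ∃[ z ] ∣ S ∣ ≡ s ×
      card A? ≤ (h * (2 * n) ^ k) ^ s * card (λ x → A? x ×-dec cell? S z x)
  popular-cell t k h room {A} A? avoiding large = go
    where
    open ≤-Reasoning
    G = h * (2 * n) ^ k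
    instance
      n≢0 : NonZero n
      n≢0 = >-nonZero (≤-trans (s≤s z≤n) room)
      2n≢0 : NonZero (2 * n)
      2n≢0 = m*n≢0 2 n
      [2n]^k≢0 : NonZero ((2 * n) ^ k)
      [2n]^k≢0 = m^n≢0 (2 * n) k
      G≢0 : NonZero G
      G≢0 = m*n≢0 h _

    nonempty : 0 < card A?
    nonempty = *-cancelʳ-< (h ^ k) 0 (card A?) (≤-<-trans z≤n large)

    go : ∀ s → s ≤ suc t → ∃[ S ] ∃[ z ] ∣ S ∣ ≡ s × card A? ≤ G ^ s * card (λ x → A? x ×-dec cell? S z x)
    go zero _ = ∅ , proj₁ (card-witness A? nonempty) , ∣⊥∣≡0 n ,
      ≤-trans (card-mono A? (λ x → A? x ×-dec cell? ∅ (proj₁ (card-witness A? nonempty)) x)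
                (λ x a → a , λ i i∈⊥ → ⊥-elim (∉⊥ i∈⊥)))
              (≤-reflexive (sym (+-identityʳ _)))
    go (suc s) (s≤s s≤t) = extend (go s (m≤n⇒m≤1+n s≤t))
      where
      extend : ∃[ S ] ∃[ z ] ∣ S ∣ ≡ s × card A? ≤ G ^ s * card (λ x → A? x ×-dec cell? S z x) →
               ∃[ S ] ∃[ z ] ∣ S ∣ ≡ suc s × card A? ≤ G ^ suc s * card (λ x → A? x ×-dec cell? S z x)
      extend (S , z , ∣S∣≡s , A≤) = S ∪ ⁅ i ⁆ , z [ i ]≔ u , trans (∣p∪⁅i⁆∣ S i i∉S) (cong suc ∣S∣≡s) , (begin
        card A?                   ≤⟨ A≤ ⟩
        G ^ s * card B?           ≤⟨ *-monoʳ-≤ (G ^ s) B≤ ⟩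
        G ^ s * (G * card Bᵢ?)    ≡⟨ shuffle (G ^ s) G (card Bᵢ?) ⟩
        G ^ suc s * card Bᵢ?      ≤⟨ *-monoʳ-≤ (G ^ suc s) (card-mono Bᵢ? (λ x → A? x ×-dec cell? (S ∪ ⁅ i ⁆) (z [ i ]≔ u) x)
                                       (λ { x ((a , x≈z) , xi≡u) → a , update-≈ S i z {x} i∉S x≈z xi≡u })) ⟩
        G ^ suc s * card (λ x → A? x ×-dec cell? (S ∪ ⁅ i ⁆) (z [ i ]≔ u) x) ∎)
        where
        shuffle : ∀ a b c → a * (b * c) ≡ b * a * c
        shuffle = solve-∀
        B? = λ x → A? x ×-dec cell? S z x
        B-large : (2 * n) ^ k * T < card B? * h ^ k
        B-large = *-cancelˡ-< (G ^ s) _ _ (begin-strict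
          G ^ s * ((2 * n) ^ k * T)         ≤⟨ *-monoˡ-≤ ((2 * n) ^ k * T) (^-monoʳ-≤ G (m≤n⇒m≤1+n s≤t)) ⟩
          G ^ suc t * ((2 * n) ^ k * T)     <⟨ large ⟩
          card A? * h ^ k                   ≤⟨ *-monoˡ-≤ (h ^ k) A≤ ⟩
          G ^ s * card B? * h ^ k           ≡⟨ *-assoc (G ^ s) _ _ ⟩
          G ^ s * (card B? * h ^ k)         ∎)
        popular = popular-coordinate t k h room B? (λ x y bx by → avoiding x y (proj₁ bx) (proj₁ by)) S
          (≤-trans (≤-reflexive ∣S∣≡s) s≤t)
          (λ {x} {y} bx by → ≈-trans {S = S} {x} {z} {y} (proj₂ bx) (≈-sym {S = S} {y} {z} (proj₂ by))) B-large
        i = proj₁ popular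
        u = proj₁ (proj₂ popular)
        i∉S = proj₁ (proj₂ (proj₂ popular))
        B≤ = proj₂ (proj₂ (proj₂ popular))
        Bᵢ? = λ x → B? x ×-dec (lookup x i ≟ u)

  -- Typical restrictions

  -- The words of B that agree with u at one given i outside `Q` lie in a single cell of
  -- co-dimension ∣Q∣ + 1. At most n such parts cannot exhaust B.
  exists-off : {B : Pred (Word m n) 0ℓ} (B? : Decidable B) (Q : Subset n) (u : Word m n) →
    (∀ {x y} → B x → B y → x ≈[ Q ] y) → n * T < card B? * m ^ suc ∣ Q ∣ →
    ∃[ x ] B x × (∀ i → i ∉ Q → lookup x i ≢ lookup u i)
  exists-off {B} B? Q u agree large = decide (0 <? card good?)
    where
    open ≤-Reasoning
    M = m ^ suc ∣ Q ∣
    good? : Decidable (λ x → B x × (∀ i → i ∉ Q → lookup x i ≢ lookup u i))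
    good? x = B? x ×-dec all? (λ i → ¬? (i ∈? Q) →-dec ¬? (lookup x i ≟ lookup u i))
    bad? : ∀ i → Decidable (λ x → B x × i ∉ Q × lookup x i ≡ lookup u i)
    bad? i x = B? x ×-dec (¬? (i ∈? Q) ×-dec (lookup x i ≟ lookup u i))
    bad-bound : ∀ i → card (bad? i) * M ≤ T
    bad-bound i = decide-i (i ∈? Q)
      where
      decide-i : Dec (i ∈ Q) → card (bad? i) * M ≤ T
      decide-i (yes i∈Q) = ≤-trans (≤-reflexive (cong (_* M) (card-empty (bad? i) (λ _ b → proj₁ (proj₂ b) i∈Q)))) z≤n
      decide-i (no i∉Q) = ≤-trans (≤-reflexive (cong (λ s → card (bad? i) * m ^ s) (sym (∣p∪⁅i⁆∣ Q i i∉Q))))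
        (card-within-cell (bad? i) (Q ∪ ⁅ i ⁆) on)
        where
        on : ∀ {x y} → B x × i ∉ Q × lookup x i ≡ lookup u i → B y × i ∉ Q × lookup y i ≡ lookup u i → x ≈[ Q ∪ ⁅ i ⁆ ] y
        on (bx , _ , xi) (by , _ , yi) c c∈ with x∈p∪q⁻ Q ⁅ i ⁆ c∈
        ... | inj₁ c∈Q = agree bx by c c∈Q
        ... | inj₂ c∈i rewrite x∈⁅y⁆⇒x≡y i c∈i = trans xi (sym yi)
    decide : Dec (0 < card good?) → ∃[ x ] B x × (∀ i → i ∉ Q → lookup x i ≢ lookup u i)
    decide (yes 0<c) = card-witness good? 0<c
    decide (no ¬0<c) = contradiction large (≤⇒≯ (begin
      card B? * M                              ≤⟨ *-monoˡ-≤ M (card-⋃ B? (allFin n) bad? covered) ⟩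
      (∑[ i ← allFin n ] card (bad? i)) * M    ≡⟨ sym (∑-*ʳ (allFin n) _ M) ⟩
      ∑[ i ← allFin n ] (card (bad? i) * M)    ≤⟨ ∑-bound (allFin n) bad-bound ⟩
      length (allFin n) * T                    ≡⟨ cong (_* T) (length-allFin n) ⟩
      n * T                                    ∎))
      where
      covered : ∀ x → B x → ∃[ i ] (i ∈ˡ allFin n) × B x × i ∉ Q × lookup x i ≡ lookup u i
      covered x bx = search (any? (λ i → ¬? (i ∈? Q) ×-dec (lookup x i ≟ lookup u i)))
        where
        search : Dec (∃[ i ] i ∉ Q × lookup x i ≡ lookup u i) →
                 ∃[ i ] (i ∈ˡ allFin n) × B x × i ∉ Q × lookup x i ≡ lookup u i
        search (yes (i , i∉Q , eq)) = i , ∈-allFin i , bx , i∉Q , eq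
        search (no none) = contradiction (card-pos good? (bx , λ i i∉Q eq → none (i , i∉Q , eq))) ¬0<c

  -- There are m^∣R∣ cells, and one that contains a rare word has at most c / (m^∣R∣ d) words of A.
  card-rare-cells : {A : Pred (Word m n) 0ℓ} (A? : Decidable A) (R : Subset n) (c d : ℕ) →
    card (λ x → A? x ×-dec (card (λ y → A? y ×-dec cell? R x y) * (m ^ ∣ R ∣ * d) ≤? c)) * d ≤ c
  card-rare-cells {A} A? R c d = *-cancelˡ-≤ T (begin
    T * (card rare? * d)                                               ≡⟨ shuffle T (card rare?) d ⟩
    card rare? * T * d                                                 ≡⟨ cong (_* d) (sym (∑-card-cells rare? R)) ⟩
    (∑[ z ← words m n ] card (in-cell? z)) * m ^ ∣ R ∣ * d             ≡⟨ *-assoc (∑[ z ← words m n ] card (in-cell? z)) (m ^ ∣ R ∣) d ⟩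
    (∑[ z ← words m n ] card (in-cell? z)) * (m ^ ∣ R ∣ * d)           ≡⟨ sym (∑-*ʳ (words m n) _ _) ⟩
    ∑[ z ← words m n ] (card (in-cell? z) * (m ^ ∣ R ∣ * d))           ≤⟨ ∑-bound (words m n) bound ⟩
    length (words m n) * c                                             ≡⟨ cong (_* c) (length-words m n) ⟩
    T * c                                                              ∎)
    where
    open ≤-Reasoning
    shuffle : ∀ a b c → a * (b * c) ≡ b * a * c
    shuffle = solve-∀
    rare? = λ x → A? x ×-dec (card (λ y → A? y ×-dec cell? R x y) * (m ^ ∣ R ∣ * d) ≤? c)
    in-cell? = λ z x → rare? x ×-dec cell? R z x
    bound : ∀ z → card (in-cell? z) * (m ^ ∣ R ∣ * d) ≤ c
    bound z = decide (0 <? card (in-cell? z))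
      where
      decide : Dec (0 < card (in-cell? z)) → card (in-cell? z) * (m ^ ∣ R ∣ * d) ≤ c
      decide (no ¬0<c)  = ≤-trans (≤-reflexive (cong (_* (m ^ ∣ R ∣ * d)) (n≤0⇒n≡0 (≮⇒≥ ¬0<c)))) z≤n
      decide (yes 0<c) = let x , (ax , rare) , x≈z = card-witness (in-cell? z) 0<c in
        ≤-trans (*-monoˡ-≤ (m ^ ∣ R ∣ * d) (card-mono (in-cell? z) (λ y → A? y ×-dec cell? R x y)
                  (λ { y ((ay , _) , y≈z) → ay , ≈-trans {S = R} {y} {z} {x} y≈z (≈-sym {S = R} {x} {z} x≈z) }))) rare

-- Coordinates prescribed alike by two subcubes

agreeing : Word m n → Word m n → Subset n
agreeing z z′ = tabulate (λ i → does (lookup z i ≟ lookup z′ i))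

∈-agreeing⁺ : (z z′ : Word m n) {i : Fin n} → lookup z i ≡ lookup z′ i → i ∈ agreeing z z′
∈-agreeing⁺ z z′ {i} eq = lookup⇒[]= i _ (trans (lookup∘tabulate _ i) (dec-true (lookup z i ≟ lookup z′ i) eq))

∈-agreeing⁻ : (z z′ : Word m n) {i : Fin n} → i ∈ agreeing z z′ → lookup z i ≡ lookup z′ i
∈-agreeing⁻ z z′ {i} i∈ = decidable-stable (lookup z i ≟ lookup z′ i) λ neq →
  contradiction (trans (sym ([]=⇒lookup i∈)) (trans (lookup∘tabulate _ i) (dec-false (lookup z i ≟ lookup z′ i) neq))) λ ()

-- The agreement forced on any two words taken from the two subcubes.
common : (S : Subset n) (z : Word m n) (S′ : Subset n) (z′ : Word m n) → Subset n
common S z S′ z′ = S ∩ (S′ ∩ agreeing z z′)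

module _ (S : Subset n) (z : Word m n) (S′ : Subset n) (z′ : Word m n) where

  ∈-common⁺ : ∀ {i} → i ∈ S → i ∈ S′ → lookup z i ≡ lookup z′ i → i ∈ common S z S′ z′
  ∈-common⁺ i∈S i∈S′ eq = x∈p∩q⁺ (i∈S , x∈p∩q⁺ (i∈S′ , ∈-agreeing⁺ z z′ eq))

  ∈-common⁻ : ∀ {i} → i ∈ common S z S′ z′ → i ∈ S × i ∈ S′ × lookup z i ≡ lookup z′ i
  ∈-common⁻ i∈ with i∈S , i∈′ ← x∈p∩q⁻ S _ i∈ with i∈S′ , i∈a ← x∈p∩q⁻ S′ _ i∈′ =
    i∈S , i∈S′ , ∈-agreeing⁻ z z′ i∈a

⊆-full : {p q : Subset n} → p ⊆ q → ∣ q ∣ ≤ ∣ p ∣ → q ⊆ p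
⊆-full {p = p} {q} p⊆q q≤p {i} i∈q = decidable-stable (i ∈? p) λ i∉p →
  <⇒≱ (p⊂q⇒∣p∣<∣q∣ (p⊆q , i , i∈q , i∉p)) q≤p

-- Elementary inequalities

^-distribʳ-* : ∀ a b k → (a * b) ^ k ≡ a ^ k * b ^ k
^-distribʳ-* a b zero    = refl
^-distribʳ-* a b (suc k) = trans (cong (a * b *_) (^-distribʳ-* a b k)) (shuffle a b (a ^ k) (b ^ k))
  where
  shuffle : ∀ a b p q → a * b * (p * q) ≡ a * p * (b * q)
  shuffle = solve-∀

m*m≤n*n⇒m≤n : ∀ a b → a * a ≤ b * b → a ≤ b
m*m≤n*n⇒m≤n a b aa≤bb = ≮⇒≥ λ b<a → <⇒≱ (*-mono-< b<a b<a) aa≤bb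

4mn≤[m+n]² : ∀ a b → 4 * (a * b) ≤ (a + b) * (a + b)
4mn≤[m+n]² a b = [ go a b , (λ b≤a → subst₂ _≤_ (cong (4 *_) (*-comm b a)) (cong (λ c → c * c) (+-comm b a)) (go b a b≤a)) ]′ (≤-total a b)
  where
  go : ∀ a b → a ≤ b → 4 * (a * b) ≤ (a + b) * (a + b)
  go a b a≤b = subst (λ b → 4 * (a * b) ≤ (a + b) * (a + b)) (m+[n∸m]≡n a≤b)
    (≤-trans (m≤m+n _ ((b ∸ a) * (b ∸ a))) (≤-reflexive (square a (b ∸ a))))
    where
    square : ∀ a c → 4 * (a * (a + c)) + c * c ≡ (a + (a + c)) * (a + (a + c))
    square = solve-∀

-- Heavy subcubes

-- The subset sub r serves two subcubes whose prescribed coordinates agree in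
-- t - r places.
record Block (t : ℕ) (U : Subset n) : Set where
  field
    R        : Subset n
    ∣R∣≡t    : ∣ R ∣ ≡ t
    disjoint : Disjoint U R
    sub      : Fin (suc t) → Subset n
    sub⊆R    : ∀ r {i} → i ∈ sub r → i ∈ R
    ∣sub∣    : ∀ r → ∣ sub r ∣ ≡ toℕ r

block : (t : ℕ) (U : Subset n) → t + ∣ U ∣ ≤ n → Block t U
block t U room = record
  { R = R ; ∣R∣≡t = ∣R∣≡t ; disjoint = proj₁ (proj₂ whole)
  ; sub = λ r → proj₁ (part r) ; sub⊆R = λ r → proj₁ (proj₂ (part r)) ; ∣sub∣ = λ r → proj₂ (proj₂ (part r)) }
  where
  whole = subset-avoiding U t room
  R = proj₁ whole
  ∣R∣≡t = proj₂ (proj₂ whole)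
  part : (r : Fin (suc t)) → ∃[ R′ ] (∀ {i} → i ∈ R′ → i ∈ R) × ∣ R′ ∣ ≡ toℕ r
  part r = subset-of-size R (toℕ r) (≤-trans (s≤s⁻¹ (toℕ<n r)) (≤-reflexive (sym ∣R∣≡t)))

module Heavy {m n : ℕ} .{{_ : NonZero m}} (t : ℕ) {F : Pred (Word m n) 0ℓ} (F? : Decidable F)
             (avoiding : Avoiding t F) where

  private
    T M : ℕ
    T = m ^ n
    M = m ^ suc t

    instance
      T≢0 : NonZero T
      T≢0 = m^n≢0 m n
      M≢0 : NonZero M
      M≢0 = m^n≢0 m (suc t)
      mM≢0 : NonZero (m * M)
      mM≢0 = m*n≢0 m M

  section? : (S : Subset n) (z : Word m n) → Decidable (λ x → F x × x ≈[ S ] z)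
  section? S z x = F? x ×-dec cell? S z x

  -- The threshold is n times the size of a subcube of co-dimension |S| + |R| + 1,
  -- so that words avoiding any given word off S and R exist (exists-off).
  Typical : (S : Subset n) (z : Word m n) (R : Subset n) (b : Word m n) → Set
  Typical S z R b = n * T < card (λ x → section? S z x ×-dec cell? R b x) * (m ^ ∣ R ∣ * m ^ suc ∣ S ∣)

  typical? : ∀ S z R b → Dec (Typical S z R b)
  typical? S z R b = n * T <? card (λ x → section? S z x ×-dec cell? R b x) * (m ^ ∣ R ∣ * m ^ suc ∣ S ∣)

  typical-resp : ∀ S R {z z′ b b′} → z ≈[ S ] z′ → b ≈[ R ] b′ → Typical S z R b → Typical S z′ R b′
  typical-resp S R {z} {z′} {b} {b′} z≈z′ b≈b′ typ = <-≤-trans typ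
    (*-monoˡ-≤ (m ^ ∣ R ∣ * m ^ suc ∣ S ∣) (card-mono (λ x → section? S z x ×-dec cell? R b x)
      (λ x → section? S z′ x ×-dec cell? R b′ x)
      (λ { x ((f , x≈z) , x≈b) → (f , ≈-trans {S = S} {x} {z} {z′} x≈z z≈z′) , ≈-trans {S = R} {x} {b} {b′} x≈b b≈b′ })))

  -- Both words are chosen with restriction b to `R`, and the order matters: x is chosen first and
  -- differs from z′ off `S ∪ R`, then y differs from x off `S′ ∪ R`. A coordinate of `S′` outside
  -- `S` is safe by the choice of x, one outside `S′` by the choice of y, so only `common` and `R`
  -- remain.
  typical-conflict : ∀ S z S′ z′ R b → Disjoint S R → Disjoint S′ R →
    ∣ common S z S′ z′ ∣ + ∣ R ∣ ≡ t → Typical S z R b → Typical S′ z′ R b → ⊥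
  typical-conflict S z S′ z′ R b S∩R S′∩R size typ typ′ =
    avoiding x y Fx Fy (trans (agreement-on x y (C ∪ R) on off)
      (trans (∣p∪q∣≡∣p∣+∣q∣ C R (λ i∈C → S∩R (proj₁ (∈-common⁻ S z S′ z′ i∈C)))) size))
    where
    C = common S z S′ z′
    large : ∀ S z → Disjoint S R → Typical S z R b →
            n * T < card (λ x → section? S z x ×-dec cell? R b x) * m ^ suc ∣ S ∪ R ∣
    large S z S∩R typ = <-≤-trans typ (≤-reflexive (cong (card (λ x → section? S z x ×-dec cell? R b x) *_)
      (trans (sym (^-distribˡ-+-* m ∣ R ∣ (suc ∣ S ∣))) (cong (m ^_)
        (trans (+-comm ∣ R ∣ _) (cong suc (sym (∣p∪q∣≡∣p∣+∣q∣ S R S∩R))))))))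
    agree : ∀ S z {x y} → (F x × x ≈[ S ] z) × x ≈[ R ] b → (F y × y ≈[ S ] z) × y ≈[ R ] b → x ≈[ S ∪ R ] y
    agree S z ((_ , x≈z) , x≈b) ((_ , y≈z) , y≈b) c c∈ with x∈p∪q⁻ S R c∈
    ... | inj₁ c∈S = trans (x≈z c c∈S) (sym (y≈z c c∈S))
    ... | inj₂ c∈R = trans (x≈b c c∈R) (sym (y≈b c c∈R))
    found-x = exists-off (λ x → section? S z x ×-dec cell? R b x) (S ∪ R) z′
                (λ {x} {y} → agree S z {x} {y}) (large S z S∩R typ)
    x = proj₁ found-x
    Fx = proj₁ (proj₁ (proj₁ (proj₂ found-x)))
    x≈z = proj₂ (proj₁ (proj₁ (proj₂ found-x)))
    x≈b = proj₂ (proj₁ (proj₂ found-x))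
    x≢z′ = proj₂ (proj₂ found-x)
    found-y = exists-off (λ y → section? S′ z′ y ×-dec cell? R b y) (S′ ∪ R) x
                (λ {x} {y} → agree S′ z′ {x} {y}) (large S′ z′ S′∩R typ′)
    y = proj₁ found-y
    Fy = proj₁ (proj₁ (proj₁ (proj₂ found-y)))
    y≈z′ = proj₂ (proj₁ (proj₁ (proj₂ found-y)))
    y≈b = proj₂ (proj₁ (proj₂ found-y))
    y≢x = proj₂ (proj₂ found-y)
    on : x ≈[ C ∪ R ] y
    on c c∈ = [ (λ c∈C → let c∈S , c∈S′ , eq = ∈-common⁻ S z S′ z′ c∈C in
                    trans (x≈z c c∈S) (trans eq (sym (y≈z′ c c∈S′))))
              , (λ c∈R → trans (x≈b c c∈R) (sym (y≈b c c∈R))) ]′ (x∈p∪q⁻ C R c∈)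
    off : ∀ i → i ∉ C ∪ R → lookup x i ≢ lookup y i
    off i i∉ xi≡yi = by-S′ (i ∈? S′)
      where
      i∉R : i ∉ R
      i∉R i∈R = i∉ (x∈p∪q⁺ (inj₂ i∈R))
      i∉∪ : ∀ S → i ∉ S → i ∉ S ∪ R
      i∉∪ S i∉S i∈ = [ i∉S , i∉R ]′ (x∈p∪q⁻ S R i∈)
      by-S′ : Dec (i ∈ S′) → ⊥
      by-S′ (no i∉S′)  = y≢x i (i∉∪ S′ i∉S′) (sym xi≡yi)
      by-S′ (yes i∈S′) = by-S (i ∈? S)
        where
        xi≡z′i = trans xi≡yi (y≈z′ i i∈S′)
        by-S : Dec (i ∈ S) → ⊥
        by-S (no i∉S)  = x≢z′ i (i∉∪ S i∉S) xi≡z′i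
        by-S (yes i∈S) = i∉ (x∈p∪q⁺ (inj₁ (∈-common⁺ S z S′ z′ i∈S i∈S′ (trans (sym (x≈z i i∈S)) xi≡z′i))))

  module _ {U : Subset n} (ρ : Block t U) where

    open Block ρ

    -- Demanding all r at once makes this a property of one subcube, whatever subcube it is compared
    -- with. `∑-mass` needs this, since it compares all subcubes over `S` simultaneously.
    BlockTypical : (S : Subset n) (z b : Word m n) → Set
    BlockTypical S z b = ∀ r → Typical S z (sub r) b

    blockTypical? : ∀ S z b → Dec (BlockTypical S z b)
    blockTypical? S z b = all? (λ r → typical? S z (sub r) b)

    mass : (S : Subset n) (z : Word m n) → ℕ
    mass S z = card (blockTypical? S z)

    blockTypical-dep : ∀ S z → DependsOn R (BlockTypical S z)
    blockTypical-dep S z b b′ b≈b′ typ r =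
      typical-resp S (sub r) {z} {z} {b} {b′} (λ _ _ → refl) (λ i i∈ → b≈b′ i (sub⊆R r i∈)) (typ r)

    block-conflict : ∀ S z S′ z′ b → S ⊆ U → S′ ⊆ U → ∣ common S z S′ z′ ∣ ≤ t →
      BlockTypical S z b → BlockTypical S′ z′ b → ⊥
    block-conflict S z S′ z′ b S⊆U S′⊆U C≤t typ typ′ =
      typical-conflict S z S′ z′ (sub r) b
        (λ i∈S i∈r → disjoint (S⊆U i∈S) (sub⊆R r i∈r)) (λ i∈S i∈r → disjoint (S′⊆U i∈S) (sub⊆R r i∈r))
        (trans (cong (C +_) (trans (∣sub∣ r) (toℕ-fromℕ< r<))) (m+[n∸m]≡n C≤t)) (typ r) (typ′ r)
      where
      C = ∣ common S z S′ z′ ∣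
      r< : t ∸ C < suc t
      r< = s≤s (m∸n≤m t C)
      r = fromℕ< r<

    -- An atypical word lies in a rare cell for one of the t + 1 sets `sub r`. Relative to the
    -- subcube, of size T/M, such words have proportion at most (t+1)n/m.
    card-atypical : ∀ S z → ∣ S ∣ ≡ suc t →
      card (λ x → section? S z x ×-dec ¬? (blockTypical? S z x)) * (m * M) ≤ suc t * (n * T)
    card-atypical S z ∣S∣ = begin
      card (λ x → section? S z x ×-dec ¬? (blockTypical? S z x)) * (m * M)
        ≤⟨ *-monoˡ-≤ (m * M) (card-⋃ (λ x → section? S z x ×-dec ¬? (blockTypical? S z x)) (allFin (suc t)) rare? atypical) ⟩
      (∑[ r ← allFin (suc t) ] card (rare? r)) * (m * M)
        ≡⟨ sym (∑-*ʳ (allFin (suc t)) (λ r → card (rare? r)) (m * M)) ⟩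
      ∑[ r ← allFin (suc t) ] (card (rare? r) * (m * M))
        ≤⟨ ∑-bound (allFin (suc t)) (λ r → ≤-trans (≤-reflexive (cong (λ s → card (rare? r) * m ^ suc s) (sym ∣S∣)))
             (card-rare-cells (section? S z) (sub r) (n * T) (m ^ suc ∣ S ∣))) ⟩
      length (allFin (suc t)) * (n * T)
        ≡⟨ cong (_* (n * T)) (length-allFin (suc t)) ⟩
      suc t * (n * T) ∎
      where
      open ≤-Reasoning
      rare? = λ r x → section? S z x ×-dec
        (card (λ y → section? S z y ×-dec cell? (sub r) x y) * (m ^ ∣ sub r ∣ * m ^ suc ∣ S ∣) ≤? n * T)
      atypical : ∀ x → (F x × x ≈[ S ] z) × ¬ BlockTypical S z x →
        ∃[ r ] (r ∈ˡ allFin (suc t)) × (F x × x ≈[ S ] z) ×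
          (card (λ y → section? S z y ×-dec cell? (sub r) x y) * (m ^ ∣ sub r ∣ * m ^ suc ∣ S ∣) ≤ n * T)
      atypical x (a , ¬typ) = let r , ¬typ-r = ¬∀⟶∃¬ (suc t) (λ r → Typical S z (sub r) x) (λ r → typical? S z (sub r) x) ¬typ in
        r , ∈-allFin r , a , ≮⇒≥ ¬typ-r

    module _ (S : Subset n) (z : Word m n) (∣S∣ : ∣ S ∣ ≡ suc t)
             {E : Pred (Word m n) 0ℓ} (E? : Decidable E) (E-dep : DependsOn U E) where

      restrict? : Decidable (λ x → E x × BlockTypical S z x)
      restrict? x = E? x ×-dec blockTypical? S z x

      card-restrict : card restrict? * T ≡ card E? * mass S z
      card-restrict = card-independent E? (blockTypical? S z) U R disjoint E-dep (blockTypical-dep S z)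

      restrict-dep : DependsOn (U ∪ R) (λ x → E x × BlockTypical S z x)
      restrict-dep x y x≈y (e , typ) =
        E-dep x y (λ i i∈U → x≈y i (x∈p∪q⁺ (inj₁ i∈U))) e ,
        blockTypical-dep S z x y (λ i i∈R → x≈y i (x∈p∪q⁺ (inj₂ i∈R))) typ

      -- Losses add up over the blocks, while `card-restrict` shrinks the event multiplicatively.
      -- This contrast is what makes many blocks profitable.
      card-lost : ∀ j → card (λ x → section? S z x ×-dec ¬? (E? x)) * (m * M) ≤ j * (suc t * (n * T)) →
                  card (λ x → section? S z x ×-dec ¬? (restrict? x)) * (m * M) ≤ suc j * (suc t * (n * T))
      card-lost j lost = begin
        card (λ x → section? S z x ×-dec ¬? (restrict? x)) * (m * M)
          ≤⟨ *-monoˡ-≤ (m * M) (card-∪ (λ x → section? S z x ×-dec ¬? (restrict? x)) B₁? B₂? split) ⟩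
        (card B₁? + card B₂?) * (m * M)
          ≡⟨ *-distribʳ-+ (m * M) (card B₁?) (card B₂?) ⟩
        card B₁? * (m * M) + card B₂? * (m * M)
          ≤⟨ +-mono-≤ (card-atypical S z ∣S∣) lost ⟩
        suc j * (suc t * (n * T)) ∎
        where
        open ≤-Reasoning
        B₁? = λ x → section? S z x ×-dec ¬? (blockTypical? S z x)
        B₂? = λ x → section? S z x ×-dec ¬? (E? x)
        split : ∀ x → (F x × x ≈[ S ] z) × ¬ (E x × BlockTypical S z x) →
                ((F x × x ≈[ S ] z) × ¬ BlockTypical S z x) ⊎ ((F x × x ≈[ S ] z) × ¬ E x)
        split x (a , ¬both) = decide (E? x)
          where
          decide : Dec (E x) → ((F x × x ≈[ S ] z) × ¬ BlockTypical S z x) ⊎ ((F x × x ≈[ S ] z) × ¬ E x)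
          decide (yes e) = inj₁ (a , λ typ → ¬both (e , typ))
          decide (no ¬e) = inj₂ (a , ¬e)

  disjoint-masses : {U : Subset n} (ρ : Block t U) → ∀ S z S′ z′ → S ⊆ U → S′ ⊆ U →
    ∣ common S z S′ z′ ∣ ≤ t → mass ρ S z + mass ρ S′ z′ ≤ T
  disjoint-masses ρ S z S′ z′ S⊆U S′⊆U C≤t = begin
    mass ρ S z + mass ρ S′ z′
      ≡⟨ cong₂ _+_ (card-∑ V?) (card-∑ V′?) ⟩
    (∑[ b ← words m n ] χ (V? b)) + (∑[ b ← words m n ] χ (V′? b))
      ≡⟨ sym (∑-+ (words m n) _ _) ⟩
    ∑[ b ← words m n ] (χ (V? b) + χ (V′? b))
      ≤⟨ ∑-bound (words m n) (λ b → at-most-one b (V? b) (V′? b)) ⟩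
    length (words m n) * 1
      ≡⟨ trans (*-identityʳ _) (length-words m n) ⟩
    T ∎
    where
    open ≤-Reasoning
    V?  = blockTypical? ρ S z
    V′? = blockTypical? ρ S′ z′
    at-most-one : ∀ b (d : Dec (BlockTypical ρ S z b)) (d′ : Dec (BlockTypical ρ S′ z′ b)) → χ d + χ d′ ≤ 1
    at-most-one b (no _)  d′     = χ≤1 d′
    at-most-one b (yes _) (no _) = ≤-refl
    at-most-one b (yes v) (yes v′) = ⊥-elim (block-conflict ρ S z S′ z′ b S⊆U S′⊆U C≤t v v′)

  -- A restriction b is typical for at most one subcube over `S`: if z and z′ differ somewhere on
  -- `S`, their common part has at most t coordinates and `block-conflict` applies. So each b is
  -- counted by the T/M words of one cell at most.
  ∑-mass : {U : Subset n} (ρ : Block t U) → ∀ S → S ⊆ U → ∣ S ∣ ≡ suc t →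
           (∑[ z ← words m n ] mass ρ S z) * M ≤ T * T
  ∑-mass ρ S S⊆U ∣S∣ = begin
    (∑[ z ← words m n ] mass ρ S z) * M
      ≡⟨ cong (_* M) (trans (∑-cong (words m n) (λ z → card-∑ (blockTypical? ρ S z))) (∑-swap (words m n) (words m n) _)) ⟩
    (∑[ b ← words m n ] ∑[ z ← words m n ] χ (blockTypical? ρ S z b)) * M
      ≡⟨ cong (_* M) (∑-cong (words m n) (λ b → sym (card-∑ (λ z → blockTypical? ρ S z b)))) ⟩
    (∑[ b ← words m n ] card (λ z → blockTypical? ρ S z b)) * M
      ≡⟨ sym (∑-*ʳ (words m n) (λ b → card (λ z → blockTypical? ρ S z b)) M) ⟩
    ∑[ b ← words m n ] (card (λ z → blockTypical? ρ S z b) * M)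
      ≤⟨ ∑-bound (words m n) (λ b → subst (λ s → card (λ z → blockTypical? ρ S z b) * m ^ s ≤ T) ∣S∣
           (card-within-cell (λ z → blockTypical? ρ S z b) S (λ {z} {z′} → same-cell b z z′))) ⟩
    length (words m n) * T
      ≡⟨ cong (_* T) (length-words m n) ⟩
    T * T ∎
    where
    open ≤-Reasoning
    same-cell : ∀ b z z′ → BlockTypical ρ S z b → BlockTypical ρ S z′ b → z ≈[ S ] z′
    same-cell b z z′ v v′ i i∈S = proj₂ (proj₂ (∈-common⁻ S z S z′ (full i∈S)))
      where
      full : S ⊆ common S z S z′
      full = ⊆-full {p = common S z S z′} {S} (λ c∈ → proj₁ (∈-common⁻ S z S z′ c∈))
        (≮⇒≥ λ C<S → block-conflict ρ S z S z′ b S⊆U S⊆U (s≤s⁻¹ (≤-trans C<S (≤-reflexive ∣S∣))) v v′)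

  -- Comparison of two heavy subcubes

  module Pair (Q k : ℕ) (m-large : 2 * (k * (suc t * n)) * Q ≤ m) where

    IsHeavy : Subset n → Word m n → Set
    IsHeavy S z = T ≤ card (section? S z) * (Q * M)

    heavy? : ∀ S z → Dec (IsHeavy S z)
    heavy? S z = T ≤? card (section? S z) * (Q * M)

    -- A heavy section has at least T/(QM) words, and `m-large` is the condition under which k
    -- blocks together lose at most half of them.
    retained : ∀ S z → IsHeavy S z → {E : Pred (Word m n) 0ℓ} (E? : Decidable E) → ∀ j → j ≤ k →
      card (λ x → section? S z x ×-dec ¬? (E? x)) * (m * M) ≤ j * (suc t * (n * T)) →
      card (section? S z) ≤ 2 * card E?
    retained S z heavy {E} E? j j≤k lost = m≤n+p⇒2p≤m⇒m≤2n a (card E?) e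
      (card-∪ (section? S z) E? (λ x → section? S z x ×-dec ¬? (E? x)) split)
      (*-cancelʳ-≤ (2 * e) a (m * M) (begin
        2 * e * (m * M)                              ≡⟨ *-assoc 2 e (m * M) ⟩
        2 * (e * (m * M))                            ≤⟨ *-monoʳ-≤ 2 lost ⟩
        2 * (j * (suc t * (n * T)))                  ≤⟨ *-monoʳ-≤ 2 (*-monoˡ-≤ (suc t * (n * T)) j≤k) ⟩
        2 * (k * (suc t * (n * T)))                  ≡⟨ shuffle₁ k (suc t) n T ⟩
        2 * (k * (suc t * n)) * T                    ≤⟨ *-monoʳ-≤ (2 * (k * (suc t * n))) heavy ⟩
        2 * (k * (suc t * n)) * (a * (Q * M))        ≡⟨ shuffle₂ (2 * (k * (suc t * n))) a Q M ⟩
        a * (2 * (k * (suc t * n)) * Q * M)          ≤⟨ *-monoʳ-≤ a (*-monoˡ-≤ M m-large) ⟩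
        a * (m * M)                                  ∎))
      where
      open ≤-Reasoning
      a = card (section? S z)
      e = card (λ x → section? S z x ×-dec ¬? (E? x))
      shuffle₁ : ∀ k t n T → 2 * (k * (t * (n * T))) ≡ 2 * (k * (t * n)) * T
      shuffle₁ = solve-∀
      shuffle₂ : ∀ c a Q M → c * (a * (Q * M)) ≡ a * (c * Q * M)
      shuffle₂ = solve-∀
      split : ∀ x → F x × x ≈[ S ] z → E x ⊎ ((F x × x ≈[ S ] z) × ¬ E x)
      split x a = decide (E? x)
        where
        decide : Dec (E x) → E x ⊎ ((F x × x ≈[ S ] z) × ¬ E x)
        decide (yes e) = inj₁ e
        decide (no ¬e) = inj₂ (a , ¬e)

    lost-start : ∀ S z → card (λ x → section? S z x ×-dec ¬? (cell? S z x)) * (m * M) ≤ 0 * (suc t * (n * T))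
    lost-start S z = ≤-reflexive (cong (_* (m * M))
      (card-empty (λ x → section? S z x ×-dec ¬? (cell? S z x)) (λ { x ((_ , x≈z) , x≉z) → x≉z x≈z })))

    cell-dep : (S : Subset n) (z : Word m n) → DependsOn S (λ x → x ≈[ S ] z)
    cell-dep S z x y x≈y x≈z = ≈-trans {S = S} {y} {x} {z} (≈-sym {S = S} {x} {y} x≈y) x≈z

    -- With two blocks the bound is a product of two masses, so its square root is at most a linear
    -- expression in them; one block would leave the square root of a mass, which `∑-mass` does not
    -- control.
    two-blocks : ∀ S z → ∣ S ∣ ≡ suc t → IsHeavy S z → 2 ≤ k →
      (ρ₁ : Block t S) (ρ₂ : Block t (S ∪ Block.R ρ₁)) →
      card (section? S z) * M * T ≤ 2 * (mass ρ₁ S z * mass ρ₂ S z)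
    two-blocks S z ∣S∣ heavy 2≤k ρ₁ ρ₂ = *-cancelʳ-≤ _ _ T (begin
      a * M * T * T                 ≤⟨ *-monoˡ-≤ T (*-monoˡ-≤ T (*-monoˡ-≤ M (retained S z heavy E₂? 2 2≤k
                                          (card-lost ρ₂ S z ∣S∣ E₁? E₁-dep 1 (card-lost ρ₁ S z ∣S∣ E₀? E₀-dep 0 (lost-start S z)))))) ⟩
      2 * card E₂? * M * T * T      ≡⟨ shuffle₁ (card E₂?) M T ⟩
      2 * (card E₂? * T * T * M)    ≡⟨ cong (λ e → 2 * (e * T * M)) (card-restrict ρ₂ S z ∣S∣ E₁? E₁-dep) ⟩
      2 * (card E₁? * p₂ * T * M)   ≡⟨ shuffle₂ (card E₁?) p₂ T M ⟩
      2 * (card E₁? * T * p₂ * M)   ≡⟨ cong (λ e → 2 * (e * p₂ * M)) (card-restrict ρ₁ S z ∣S∣ E₀? E₀-dep) ⟩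
      2 * (card E₀? * p₁ * p₂ * M)  ≡⟨ shuffle₃ (card E₀?) p₁ p₂ M ⟩
      2 * (p₁ * p₂) * (card E₀? * M) ≡⟨ cong (2 * (p₁ * p₂) *_) (subst (λ s → card E₀? * m ^ s ≡ T) ∣S∣ (card-cell S z)) ⟩
      2 * (p₁ * p₂) * T             ∎)
      where
      open ≤-Reasoning
      a = card (section? S z)
      p₁ = mass ρ₁ S z
      p₂ = mass ρ₂ S z
      E₀? = cell? S z
      E₀-dep : DependsOn S (λ x → x ≈[ S ] z)
      E₀-dep = cell-dep S z
      E₁? = restrict? ρ₁ S z ∣S∣ E₀? E₀-dep
      E₁-dep : DependsOn (S ∪ Block.R ρ₁) (λ x → x ≈[ S ] z × BlockTypical ρ₁ S z x)
      E₁-dep = restrict-dep ρ₁ S z ∣S∣ E₀? E₀-dep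
      E₂? = restrict? ρ₂ S z ∣S∣ E₁? E₁-dep
      shuffle₁ : ∀ e M T → 2 * e * M * T * T ≡ 2 * (e * T * T * M)
      shuffle₁ = solve-∀
      shuffle₂ : ∀ e p T M → 2 * (e * p * T * M) ≡ 2 * (e * T * p * M)
      shuffle₂ = solve-∀
      shuffle₃ : ∀ e p q M → 2 * (e * p * q * M) ≡ 2 * (p * q) * (e * M)
      shuffle₃ = solve-∀

    module _ (S : Subset n) (z : Word m n) (∣S∣ : ∣ S ∣ ≡ suc t)
             (S′ : Subset n) (z′ : Word m n) (∣S′∣ : ∣ S′ ∣ ≡ suc t)
             (C≤t : ∣ common S z S′ z′ ∣ ≤ t) (room : suc t * (2 + k) ≤ n) where

      -- The same blocks serve both subcubes, whose typical restrictions are disjoint on each block.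
      -- Every block thus divides the product of the two sizes by at least 4, although neither
      -- factor need shrink by itself.
      record PairStage (j : ℕ) : Set₁ where
        field
          {E E′}   : Pred (Word m n) 0ℓ
          E?       : Decidable E
          E′?      : Decidable E′
          U        : Subset n
          S⊆U      : S ⊆ U
          S′⊆U     : S′ ⊆ U
          ∣U∣≤     : ∣ U ∣ ≤ suc t * (2 + j)
          E-dep    : DependsOn U E
          E′-dep   : DependsOn U E′
          lost     : card (λ x → section? S z x ×-dec ¬? (E? x)) * (m * M) ≤ j * (suc t * (n * T))
          lost′    : card (λ x → section? S′ z′ x ×-dec ¬? (E′? x)) * (m * M) ≤ j * (suc t * (n * T))
          product  : card E? * card E′? * 4 ^ j * (M * M) ≤ T * T

      pair-start : PairStage 0
      pair-start = record
        { E? = cell? S z ; E′? = cell? S′ z′ ; U = S ∪ S′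
        ; S⊆U = λ p → x∈p∪q⁺ (inj₁ p) ; S′⊆U = λ p → x∈p∪q⁺ (inj₂ p)
        ; ∣U∣≤ = ≤-trans (∣p∪q∣≤∣p∣+∣q∣ S S′) (≤-reflexive (trans (cong₂ _+_ ∣S∣ ∣S′∣) (double (suc t))))
        ; E-dep = λ x y x≈y → cell-dep S z x y (λ i i∈ → x≈y i (x∈p∪q⁺ (inj₁ i∈)))
        ; E′-dep = λ x y x≈y → cell-dep S′ z′ x y (λ i i∈ → x≈y i (x∈p∪q⁺ (inj₂ i∈)))
        ; lost = lost-start S z ; lost′ = lost-start S′ z′
        ; product = ≤-reflexive (trans (shuffle (card (cell? S z)) (card (cell? S′ z′)) M)
            (cong₂ _*_ (subst (λ s → card (cell? S z) * m ^ s ≡ T) ∣S∣ (card-cell S z))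
                       (subst (λ s → card (cell? S′ z′) * m ^ s ≡ T) ∣S′∣ (card-cell S′ z′)))) }
        where
        double : ∀ a → a + a ≡ a * 2
        double = solve-∀
        shuffle : ∀ a b M → a * b * 1 * (M * M) ≡ a * M * (b * M)
        shuffle = solve-∀

      pair-next : ∀ {j} → j < k → PairStage j → PairStage (suc j)
      pair-next {j} j<k st = record
        { E? = E⁺? ; E′? = E′⁺? ; U = U ∪ R
        ; S⊆U = λ p → x∈p∪q⁺ (inj₁ (S⊆U p)) ; S′⊆U = λ p → x∈p∪q⁺ (inj₁ (S′⊆U p))
        ; ∣U∣≤ = begin
            ∣ U ∪ R ∣                     ≤⟨ ∣p∪q∣≤∣p∣+∣q∣ U R ⟩
            ∣ U ∣ + ∣ R ∣                 ≤⟨ +-mono-≤ ∣U∣≤ (≤-trans (≤-reflexive ∣R∣≡t) (n≤1+n t)) ⟩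
            suc t * (2 + j) + suc t       ≡⟨ trans (+-comm _ (suc t)) (sym (*-suc (suc t) (2 + j))) ⟩
            suc t * (2 + suc j)           ∎
        ; E-dep = restrict-dep ρ S z ∣S∣ E? E-dep
        ; E′-dep = restrict-dep ρ S′ z′ ∣S′∣ E′? E′-dep
        ; lost = card-lost ρ S z ∣S∣ E? E-dep j lost
        ; lost′ = card-lost ρ S′ z′ ∣S′∣ E′? E′-dep j lost′
        ; product = *-cancelʳ-≤ _ (T * T) (T * T) {{m*n≢0 T T}} (begin
            card E⁺? * card E′⁺? * (4 * 4 ^ j) * (M * M) * (T * T)
              ≡⟨ shuffle₁ (card E⁺?) (card E′⁺?) (4 ^ j) (M * M) T ⟩
            card E⁺? * T * (card E′⁺? * T) * (4 * 4 ^ j * (M * M))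
              ≡⟨ cong₂ (λ e e′ → e * e′ * (4 * 4 ^ j * (M * M)))
                   (card-restrict ρ S z ∣S∣ E? E-dep) (card-restrict ρ S′ z′ ∣S′∣ E′? E′-dep) ⟩
            card E? * p * (card E′? * p′) * (4 * 4 ^ j * (M * M))
              ≡⟨ shuffle₂ (card E?) p (card E′?) p′ (4 ^ j) (M * M) ⟩
            card E? * card E′? * 4 ^ j * (M * M) * (4 * (p * p′))
              ≤⟨ *-mono-≤ product (≤-trans (4mn≤[m+n]² p p′) (*-mono-≤ p+p′≤T p+p′≤T)) ⟩
            T * T * (T * T) ∎) }
        where
        open PairStage st
        open ≤-Reasoning
        ρ : Block t U
        ρ = block t U (begin
          t + ∣ U ∣                       ≤⟨ +-mono-≤ (n≤1+n t) ∣U∣≤ ⟩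
          suc t + suc t * (2 + j)         ≡⟨ sym (*-suc (suc t) (2 + j)) ⟩
          suc t * (2 + suc j)             ≤⟨ *-monoʳ-≤ (suc t) (+-monoʳ-≤ 2 j<k) ⟩
          suc t * (2 + k)                 ≤⟨ room ⟩
          n                               ∎)
        open Block ρ using (R; ∣R∣≡t)
        p = mass ρ S z
        p′ = mass ρ S′ z′
        p+p′≤T : p + p′ ≤ T
        p+p′≤T = disjoint-masses ρ S z S′ z′ S⊆U S′⊆U C≤t
        E⁺? = restrict? ρ S z ∣S∣ E? E-dep
        E′⁺? = restrict? ρ S′ z′ ∣S′∣ E′? E′-dep
        shuffle₁ : ∀ e e′ q M T → e * e′ * (4 * q) * M * (T * T) ≡ e * T * (e′ * T) * (4 * q * M)
        shuffle₁ = solve-∀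
        shuffle₂ : ∀ e p e′ p′ q M → e * p * (e′ * p′) * (4 * q * M) ≡ e * e′ * q * M * (4 * (p * p′))
        shuffle₂ = solve-∀

      pair-stage : ∀ j → j ≤ k → PairStage j
      pair-stage zero    _   = pair-start
      pair-stage (suc j) j<k = pair-next j<k (pair-stage j (<⇒≤ j<k))

      -- Only the product of the two sections is controlled, so the bound concerns the smaller one,
      -- through a² ≤ a a′. The larger one inherits heaviness, which lets `retained` apply to both.
      pair-bound : IsHeavy S z → card (section? S z) ≤ card (section? S′ z′) →
                   card (section? S z) * 2 ^ k * M ≤ 2 * T
      pair-bound heavy a≤a′ = m*m≤n*n⇒m≤n _ _ (begin
        a * 2 ^ k * M * (a * 2 ^ k * M)              ≡⟨ shuffle₁ a (2 ^ k) M ⟩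
        a * a * (2 ^ k * 2 ^ k) * (M * M)            ≡⟨ cong (λ q → a * a * q * (M * M)) (sym (^-distribʳ-* 2 2 k)) ⟩
        a * a * 4 ^ k * (M * M)                      ≤⟨ *-monoˡ-≤ (M * M) (*-monoˡ-≤ (4 ^ k) (*-mono-≤ a≤2E a≤2E′)) ⟩
        2 * card E? * (2 * card E′?) * 4 ^ k * (M * M) ≡⟨ shuffle₂ (card E?) (card E′?) (4 ^ k) (M * M) ⟩
        4 * (card E? * card E′? * 4 ^ k * (M * M))   ≤⟨ *-monoʳ-≤ 4 product ⟩
        4 * (T * T)                                  ≡⟨ shuffle₃ T ⟩
        2 * T * (2 * T)                              ∎)
        where
        open PairStage (pair-stage k ≤-refl)
        open ≤-Reasoning
        a = card (section? S z)
        heavy′ : IsHeavy S′ z′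
        heavy′ = ≤-trans heavy (*-monoˡ-≤ (Q * M) a≤a′)
        a≤2E : a ≤ 2 * card E?
        a≤2E = retained S z heavy E? k ≤-refl lost
        a≤2E′ : a ≤ 2 * card E′?
        a≤2E′ = ≤-trans a≤a′ (retained S′ z′ heavy′ E′? k ≤-refl lost′)
        shuffle₁ : ∀ a q M → a * q * M * (a * q * M) ≡ a * a * (q * q) * (M * M)
        shuffle₁ = solve-∀
        shuffle₂ : ∀ e e′ q M → 2 * e * (2 * e′) * q * M ≡ 4 * (e * e′ * q * M)
        shuffle₂ = solve-∀
        shuffle₃ : ∀ T → 4 * (T * T) ≡ 2 * T * (2 * T)
        shuffle₃ = solve-∀

-- The product of the hypotheses bounds the square of a M q by 4 p p′, and the arithmetic mean
-- dominates the geometric one.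
geometric-mean-bound : ∀ a q M T p p′ → .{{NonZero T}} → a * (q * q) * M ≤ 2 * T → a * M * T ≤ 2 * (p * p′) →
                       a * M * q ≤ p + p′
geometric-mean-bound a q M T p p′ small₁ small₂ = m*m≤n*n⇒m≤n (a * M * q) (p + p′) (*-cancelʳ-≤ _ _ T (begin
  a * M * q * (a * M * q) * T          ≡⟨ shuffle₁ a M q T ⟩
  a * (q * q) * M * (a * M * T)        ≤⟨ *-mono-≤ small₁ small₂ ⟩
  2 * T * (2 * (p * p′))               ≡⟨ shuffle₂ T p p′ ⟩
  4 * (p * p′) * T                     ≤⟨ *-monoˡ-≤ T (4mn≤[m+n]² p p′) ⟩
  (p + p′) * (p + p′) * T              ∎))
  where
  open ≤-Reasoning
  shuffle₁ : ∀ a M q T → a * M * q * (a * M * q) * T ≡ a * (q * q) * M * (a * M * T)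
  shuffle₁ = solve-∀
  shuffle₂ : ∀ T p p′ → 2 * T * (2 * (p * p′)) ≡ 4 * (p * p′) * T
  shuffle₂ = solve-∀

-- Enumeration of the coordinate sets of a given size

combinations : ∀ n → ℕ → List (Subset n)
combinations zero    zero    = [] ∷ []
combinations zero    (suc d) = []
combinations (suc n) zero    = map (outside ∷_) (combinations n zero)
combinations (suc n) (suc d) = map (inside ∷_) (combinations n d) ++ map (outside ∷_) (combinations n (suc d))

∈-combinations : (S : Subset n) → S ∈ˡ combinations n ∣ S ∣
∈-combinations []            = here refl
∈-combinations (inside ∷ S)  = ∈-++⁺ˡ (∈-map⁺ (inside ∷_) (∈-combinations S))
∈-combinations {suc n} (outside ∷ S) with ∣ S ∣ | ∈-combinations S
... | zero  | S∈ = ∈-map⁺ (outside ∷_) S∈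
... | suc d | S∈ = ∈-++⁺ʳ (map (inside ∷_) (combinations n d)) (∈-map⁺ (outside ∷_) S∈)

length-combinations : ∀ n d → length (combinations n d) ≤ suc n ^ d
length-combinations zero    zero    = ≤-refl
length-combinations zero    (suc d) = z≤n
length-combinations (suc n) zero    = ≤-trans (≤-reflexive (length-map _ (combinations n 0))) (length-combinations n 0)
length-combinations (suc n) (suc d) = begin
  length (map (inside ∷_) (combinations n d) ++ map (outside ∷_) (combinations n (suc d)))
    ≡⟨ length-++ (map (inside ∷_) (combinations n d)) ⟩
  length (map (inside ∷_) (combinations n d)) + length (map (outside ∷_) (combinations n (suc d)))
    ≡⟨ cong₂ _+_ (length-map _ (combinations n d)) (length-map _ (combinations n (suc d))) ⟩
  length (combinations n d) + length (combinations n (suc d))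
    ≤⟨ +-mono-≤ (length-combinations n d) (length-combinations n (suc d)) ⟩
  suc n ^ d + suc n * suc n ^ d
    ≤⟨ *-monoʳ-≤ (2 + n) (^-monoˡ-≤ d (n≤1+n (suc n))) ⟩
  (2 + n) ^ suc d ∎
  where open ≤-Reasoning

-- Words outside the largest section

module Structure {m n : ℕ} .{{_ : NonZero m}} (t : ℕ) {F : Pred (Word m n) 0ℓ} (F? : Decidable F)
                 (avoiding : Avoiding t F) where

  open Heavy t F? avoiding

  private
    T M : ℕ
    T = m ^ n
    M = m ^ suc t

    instance
      T≢0 : NonZero T
      T≢0 = m^n≢0 m n
      M≢0 : NonZero M
      M≢0 = m^n≢0 m (suc t)

  module HeavyPart (Q l : ℕ) (m-large : 2 * ((l + l) * (suc t * n)) * Q ≤ m)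
    (2≤2l : 2 ≤ l + l) (room : suc t * (2 + (l + l)) ≤ n)
    (S⋆ : Subset n) (z⋆ : Word m n) (∣S⋆∣ : ∣ S⋆ ∣ ≡ suc t)
    (maximal : ∀ S z → ∣ S ∣ ≡ suc t → card (section? S z) ≤ card (section? S⋆ z⋆)) where

    open Pair Q (l + l) m-large

    -- A subcube over `S` is named by any of its points, so the word x itself serves as the
    -- prescription.
    outlier? : ∀ S → Decidable (λ x → F x × ∣ S ∣ ≡ suc t × IsHeavy S x × ∣ common S x S⋆ z⋆ ∣ ≤ t)
    outlier? S x = F? x ×-dec ((∣ S ∣ ≟ⁿ suc t) ×-dec (heavy? S x ×-dec (∣ common S x S⋆ z⋆ ∣ ≤? t)))

    -- In each cell the number of outliers is at most 2^-l times a sum of two masses over M, by the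
    -- geometric mean of `pair-bound` and `two-blocks`; `∑-mass` then adds up all cells without a
    -- loss in m.
    card-outliers : ∀ S → card (outlier? S) * (2 ^ l * M) ≤ 2 * T
    card-outliers S = decide (∣ S ∣ ≟ⁿ suc t)
      where
      open ≤-Reasoning
      decide : Dec (∣ S ∣ ≡ suc t) → card (outlier? S) * (2 ^ l * M) ≤ 2 * T
      decide (no ∣S∣≢) = ≤-trans (≤-reflexive (cong (_* (2 ^ l * M))
        (card-empty (outlier? S) (λ _ x → ∣S∣≢ (proj₁ (proj₂ x)))))) z≤n
      decide (yes ∣S∣) = *-cancelʳ-≤ _ (2 * T) T (begin
        card (outlier? S) * (2 ^ l * M) * T                  ≡⟨ shuffle₁ (card (outlier? S)) (2 ^ l) M T ⟩
        card (outlier? S) * T * (2 ^ l * M)                  ≡⟨ cong (_* (2 ^ l * M)) (sym (∑-card-cells (outlier? S) S)) ⟩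
        (∑[ z ← words m n ] a z) * m ^ ∣ S ∣ * (2 ^ l * M)   ≡⟨ cong (λ s → (∑[ z ← words m n ] a z) * m ^ s * (2 ^ l * M)) ∣S∣ ⟩
        (∑[ z ← words m n ] a z) * M * (2 ^ l * M)           ≡⟨ shuffle₂ (∑[ z ← words m n ] a z) M (2 ^ l) ⟩
        (∑[ z ← words m n ] a z) * (M * 2 ^ l) * M           ≡⟨ cong (_* M) (sym (∑-*ʳ (words m n) a (M * 2 ^ l))) ⟩
        (∑[ z ← words m n ] (a z * (M * 2 ^ l))) * M         ≤⟨ *-monoˡ-≤ M (∑-mono (words m n) in-cell) ⟩
        (∑[ z ← words m n ] (mass ρ₁ S z + mass ρ₂ S z)) * M ≡⟨ cong (_* M) (∑-+ (words m n) (mass ρ₁ S) (mass ρ₂ S)) ⟩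
        (∑ (words m n) (mass ρ₁ S) + ∑ (words m n) (mass ρ₂ S)) * M
          ≡⟨ *-distribʳ-+ M (∑ (words m n) (mass ρ₁ S)) _ ⟩
        ∑ (words m n) (mass ρ₁ S) * M + ∑ (words m n) (mass ρ₂ S) * M
          ≤⟨ +-mono-≤ (∑-mass ρ₁ S id ∣S∣) (∑-mass ρ₂ S (λ p → x∈p∪q⁺ (inj₁ p)) ∣S∣) ⟩
        T * T + T * T                                        ≡⟨ shuffle₃ T ⟩
        2 * T * T                                            ∎)
        where
        shuffle₁ : ∀ a q M T → a * (q * M) * T ≡ a * T * (q * M)
        shuffle₁ = solve-∀
        shuffle₂ : ∀ a M q → a * M * (q * M) ≡ a * (M * q) * M
        shuffle₂ = solve-∀
        shuffle₃ : ∀ T → T * T + T * T ≡ 2 * T * T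
        shuffle₃ = solve-∀
        four-blocks : suc t * 4 ≤ n
        four-blocks = ≤-trans (*-monoʳ-≤ (suc t) (+-monoʳ-≤ 2 2≤2l)) room
        ρ₁ : Block t S
        ρ₁ = block t S (begin
          t + ∣ S ∣                      ≡⟨ cong (t +_) ∣S∣ ⟩
          t + suc t                      ≤⟨ m≤m+n (t + suc t) (2 * t + 3) ⟩
          t + suc t + (2 * t + 3)        ≡⟨ count t ⟩
          suc t * 4                      ≤⟨ four-blocks ⟩
          n                              ∎)
          where
          count : ∀ t → t + suc t + (2 * t + 3) ≡ suc t * 4
          count = solve-∀
        ρ₂ : Block t (S ∪ Block.R ρ₁)
        ρ₂ = block t (S ∪ Block.R ρ₁) (begin
          t + ∣ S ∪ Block.R ρ₁ ∣         ≤⟨ +-monoʳ-≤ t (∣p∪q∣≤∣p∣+∣q∣ S (Block.R ρ₁)) ⟩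
          t + (∣ S ∣ + ∣ Block.R ρ₁ ∣)   ≡⟨ cong (t +_) (cong₂ _+_ ∣S∣ (Block.∣R∣≡t ρ₁)) ⟩
          t + (suc t + t)                ≤⟨ m≤m+n (t + (suc t + t)) (t + 3) ⟩
          t + (suc t + t) + (t + 3)      ≡⟨ count t ⟩
          suc t * 4                      ≤⟨ four-blocks ⟩
          n                              ∎)
          where
          count : ∀ t → t + (suc t + t) + (t + 3) ≡ suc t * 4
          count = solve-∀
        a : Word m n → ℕ
        a z = card (λ x → outlier? S x ×-dec cell? S z x)
        mass-mono : ∀ {U} (ρ : Block t U) {x z} → x ≈[ S ] z → mass ρ S x ≤ mass ρ S z
        mass-mono ρ {x} {z} x≈z = card-mono (blockTypical? ρ S x) (blockTypical? ρ S z)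
          (λ b typ r → typical-resp S (Block.sub ρ r) {x} {z} {b} {b} x≈z (λ _ _ → refl) (typ r))
        in-cell : ∀ z → a z * (M * 2 ^ l) ≤ mass ρ₁ S z + mass ρ₂ S z
        in-cell z = decide-z (0 <? a z)
          where
          decide-z : Dec (0 < a z) → a z * (M * 2 ^ l) ≤ mass ρ₁ S z + mass ρ₂ S z
          decide-z (no ¬0<a) = ≤-trans (≤-reflexive (cong (_* (M * 2 ^ l)) (n≤0⇒n≡0 (≮⇒≥ ¬0<a)))) z≤n
          decide-z (yes 0<a) = with-witness (card-witness (λ x → outlier? S x ×-dec cell? S z x) 0<a)
            where
            with-witness : ∃[ x ] (F x × ∣ S ∣ ≡ suc t × IsHeavy S x × ∣ common S x S⋆ z⋆ ∣ ≤ t) × x ≈[ S ] z →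
                           a z * (M * 2 ^ l) ≤ mass ρ₁ S z + mass ρ₂ S z
            -- Heaviness and the bound on the common part are known for the prescription x, so the
            -- cell is renamed from z to x and the masses are carried back by `mass-mono`.
            with-witness (x , (_ , _ , heavy , C≤t) , x≈z) = begin
              a z * (M * 2 ^ l)                    ≤⟨ *-monoˡ-≤ (M * 2 ^ l) (card-mono (λ y → outlier? S y ×-dec cell? S z y)
                                                        (section? S x) (λ { y ((f , _) , y≈z) →
                                                          f , ≈-trans {S = S} {y} {z} {x} y≈z (≈-sym {S = S} {x} {z} x≈z) })) ⟩
              card (section? S x) * (M * 2 ^ l)    ≡⟨ sym (*-assoc (card (section? S x)) M (2 ^ l)) ⟩
              card (section? S x) * M * 2 ^ l
                ≤⟨ geometric-mean-bound (card (section? S x)) (2 ^ l) M T (mass ρ₁ S x) (mass ρ₂ S x)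
                     (subst (λ q → card (section? S x) * q * M ≤ 2 * T) (^-distribˡ-+-* 2 l l)
                       (pair-bound S x ∣S∣ S⋆ z⋆ ∣S⋆∣ C≤t room heavy (maximal S x ∣S∣)))
                     (two-blocks S x ∣S∣ heavy 2≤2l ρ₁ ρ₂) ⟩
              mass ρ₁ S x + mass ρ₂ S x            ≤⟨ +-mono-≤ (mass-mono ρ₁ {x} {z} x≈z) (mass-mono ρ₂ {x} {z} x≈z) ⟩
              mass ρ₁ S z + mass ρ₂ S z            ∎

  -- `h-large` makes the words in no heavy subcube rare, `m-large` keeps half of a heavy section
  -- through 2l blocks, and `l-large` pays for the union over the sets `S`. The exponent `suc e`
  -- gives light words and outliers half of the allowed measure each.
  module Conclusion (h k l e : ℕ) .{{_ : NonZero h}}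
    (room₁ : suc t * (2 + k) ≤ n) (room₂ : suc t * (2 + (l + l)) ≤ n) (2≤2l : 2 ≤ l + l)
    (h-large : (h * (2 * n) ^ k) ^ suc t * (2 * n) ^ k * (M * 2 ^ suc e) ≤ h ^ k)
    (m-large : 2 * ((l + l) * (suc t * n)) * ((h * (2 * n) ^ k) ^ suc t * 2 ^ suc e) ≤ m)
    (l-large : suc n ^ suc t * 2 * 2 ^ suc e ≤ 2 ^ l) where

    private
      G Q : ℕ
      G = h * (2 * n) ^ k
      -- Reciprocal of the density, inside a subcube, of a popular cell's share 1/G^(t+1) of a set
      -- of measure 2^-(e+1)/M.
      Q = G ^ suc t * 2 ^ suc e

    open Pair Q (l + l) m-large

    private
      instance
        n≢0 : NonZero n
        n≢0 = >-nonZero (≤-trans (s≤s z≤n) room₁)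
        2n≢0 : NonZero (2 * n)
        2n≢0 = m*n≢0 2 n
        [2n]^k≢0 : NonZero ((2 * n) ^ k)
        [2n]^k≢0 = m^n≢0 (2 * n) k
        G≢0 : NonZero G
        G≢0 = m*n≢0 h _
        G^≢0 : NonZero (G ^ suc t)
        G^≢0 = m^n≢0 G (suc t)

    HeavySomewhere : Word m n → Set
    HeavySomewhere x = Any (λ S → ∣ S ∣ ≡ suc t × IsHeavy S x) (combinations n (suc t))

    heavySomewhere? : Decidable HeavySomewhere
    heavySomewhere? x = anyˡ? (λ S → (∣ S ∣ ≟ⁿ suc t) ×-dec heavy? S x) (combinations n (suc t))

    light? : Decidable (λ x → F x × ¬ HeavySomewhere x)
    light? x = F? x ×-dec ¬? (heavySomewhere? x)

    -- Otherwise the light words have a popular cell of co-dimension t + 1. By the choice of `Q` it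
    -- is heavy, yet it contains a light word.
    card-light : card light? * (M * 2 ^ suc e) ≤ T
    card-light = ≮⇒≥ λ T< → let S , z , ∣S∣ , light≤ = popular T< in refute T< S z ∣S∣ light≤
      where
      open ≤-Reasoning
      popular : T < card light? * (M * 2 ^ suc e) →
                ∃[ S ] ∃[ z ] ∣ S ∣ ≡ suc t × card light? ≤ G ^ suc t * card (λ x → light? x ×-dec cell? S z x)
      popular T< = popular-cell t k h room₁ light? (λ x y fx fy → avoiding x y (proj₁ fx) (proj₁ fy))
        (begin-strict
          G ^ suc t * ((2 * n) ^ k * T)     ≡⟨ sym (*-assoc (G ^ suc t) _ T) ⟩
          G ^ suc t * (2 * n) ^ k * T       <⟨ *-monoʳ-< (G ^ suc t * (2 * n) ^ k) {{m*n≢0 (G ^ suc t) ((2 * n) ^ k)}} T< ⟩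
          G ^ suc t * (2 * n) ^ k * (card light? * (M * 2 ^ suc e))
            ≡⟨ shuffle (G ^ suc t * (2 * n) ^ k) (card light?) (M * 2 ^ suc e) ⟩
          card light? * (G ^ suc t * (2 * n) ^ k * (M * 2 ^ suc e))
            ≤⟨ *-monoʳ-≤ (card light?) h-large ⟩
          card light? * h ^ k ∎)
        (suc t) ≤-refl
        where
        shuffle : ∀ a b c → a * (b * c) ≡ b * (a * c)
        shuffle = solve-∀
      refute : T < card light? * (M * 2 ^ suc e) → ∀ S z → ∣ S ∣ ≡ suc t →
               card light? ≤ G ^ suc t * card (λ x → light? x ×-dec cell? S z x) → ⊥
      refute T< S z ∣S∣ light≤ = with-witness (card-witness B? (*-cancelˡ-< (G ^ suc t) 0 (card B?)
          (<-≤-trans (≤-<-trans (≤-reflexive (*-zeroʳ (G ^ suc t)))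
            (*-cancelʳ-< (M * 2 ^ suc e) 0 (card light?) (≤-<-trans z≤n T<))) light≤)))
        where
        B? = λ x → light? x ×-dec cell? S z x
        shuffle : ∀ g b M w → g * b * (M * w) ≡ b * (g * w * M)
        shuffle = solve-∀
        with-witness : ∃[ x ] (F x × ¬ HeavySomewhere x) × x ≈[ S ] z → ⊥
        with-witness (x , (_ , ¬heavy) , x≈z) =
          ¬heavy (lose (subst (λ d → S ∈ˡ combinations n d) ∣S∣ (∈-combinations S)) (∣S∣ , (begin
            T                                          ≤⟨ <⇒≤ T< ⟩
            card light? * (M * 2 ^ suc e)              ≤⟨ *-monoˡ-≤ (M * 2 ^ suc e) light≤ ⟩
            G ^ suc t * card B? * (M * 2 ^ suc e)      ≡⟨ shuffle (G ^ suc t) (card B?) M (2 ^ suc e) ⟩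
            card B? * (Q * M)                          ≤⟨ *-monoˡ-≤ (Q * M) (card-mono B? (section? S x)
                                                            (λ { y ((f , _) , y≈z) → f , ≈-trans {S = S} {y} {z} {x} y≈z (≈-sym {S = S} {x} {z} x≈z) })) ⟩
            card (section? S x) * (Q * M)              ∎)))

    private
      sectionSize : Subset n × Word m n → ℕ
      sectionSize (S , z) = card (section? S z)

      some-subset : Σ[ R ∈ Subset n ] R ⊆ ⊤ × ∣ R ∣ ≡ suc t
      some-subset = subset-of-size ⊤ (suc t) (subst (suc t ≤_) (sym (∣⊤∣≡n n))
        (≤-trans (≤-reflexive (sym (*-identityʳ (suc t)))) (≤-trans (*-monoʳ-≤ (suc t) (s≤s z≤n)) room₁)))

      -- `argmax` may return its starting value, so the seed must have t + 1 coordinates for `∣S⋆∣`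
      -- to hold; its word is arbitrary.
      seed : Subset n × Word m n
      seed = proj₁ some-subset , replicate n (fromℕ< (>-nonZero⁻¹ m))

      candidates : List (Subset n × Word m n)
      candidates = filter (λ c → ∣ proj₁ c ∣ ≟ⁿ suc t) (cartesianProduct (combinations n (suc t)) (words m n))

      best : Subset n × Word m n
      best = argmax sectionSize seed candidates

      S⋆ = proj₁ best
      z⋆ = proj₂ best

      ∣S⋆∣ : ∣ S⋆ ∣ ≡ suc t
      ∣S⋆∣ = argmax-all sectionSize {P = λ c → ∣ proj₁ c ∣ ≡ suc t} {seed} {candidates} (proj₂ (proj₂ some-subset))
               (all-filter (λ c → ∣ proj₁ c ∣ ≟ⁿ suc t) (cartesianProduct (combinations n (suc t)) (words m n)))

      maximal : ∀ S z → ∣ S ∣ ≡ suc t → card (section? S z) ≤ card (section? S⋆ z⋆)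
      maximal S z ∣S∣ = allLookup (f[xs]≤f[argmax] {f = sectionSize} seed candidates)
        (∈-filter⁺ (λ c → ∣ proj₁ c ∣ ≟ⁿ suc t)
          (∈-cartesianProduct⁺ (subst (λ d → S ∈ˡ combinations n d) ∣S∣ (∈-combinations S)) (∈-words z)) ∣S∣)

      open HeavyPart Q l m-large 2≤2l room₂ S⋆ z⋆ ∣S⋆∣ maximal

    subcube : Subcube m n (suc t)
    subcube = record { R = S⋆ ; ∣R∣≡t = ∣S⋆∣ ; α = λ i _ → lookup z⋆ i }

    light-or-outlier : ∀ x → F x × ¬ Points subcube x →
      (F x × ¬ HeavySomewhere x) ⊎ Any (λ S → F x × ∣ S ∣ ≡ suc t × IsHeavy S x × ∣ common S x S⋆ z⋆ ∣ ≤ t) (combinations n (suc t))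
    light-or-outlier x (f , x∉D) = decide (heavySomewhere? x)
      where
      decide : Dec (HeavySomewhere x) → (F x × ¬ HeavySomewhere x) ⊎
        Any (λ S → F x × ∣ S ∣ ≡ suc t × IsHeavy S x × ∣ common S x S⋆ z⋆ ∣ ≤ t) (combinations n (suc t))
      decide (no ¬heavy) = inj₁ (f , ¬heavy)
      decide (yes heavy) = inj₂ (anyMap (λ { {S} (∣S∣ , hS) → f , ∣S∣ , hS , few S }) heavy)
        where
        -- A common part with t + 1 elements fills `S⋆`; then x has the values of z⋆ on all of `S⋆`
        -- and lies in the subcube.
        few : ∀ S → ∣ common S x S⋆ z⋆ ∣ ≤ t
        few S = ≮⇒≥ λ t<C → x∉D λ i i∈S⋆ → proj₂ (proj₂ (∈-common⁻ S x S⋆ z⋆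
          (⊆-full {p = common S x S⋆ z⋆} {S⋆} (λ c∈ → proj₁ (proj₂ (∈-common⁻ S x S⋆ z⋆ c∈)))
            (≤-trans (≤-reflexive ∣S⋆∣) t<C) i∈S⋆)))

    card-outside : card (F? ∖? points? subcube) * (M * 2 ^ e) ≤ T
    card-outside = *-cancelˡ-≤ 2 (begin
      2 * (card (F? ∖? points? subcube) * (M * 2 ^ e))
        ≤⟨ *-monoʳ-≤ 2 (*-monoˡ-≤ (M * 2 ^ e) split) ⟩
      2 * ((card light? + Σout) * (M * 2 ^ e))
        ≡⟨ shuffle₁ (card light?) Σout M (2 ^ e) ⟩
      card light? * (M * 2 ^ suc e) + Σout * (M * 2 ^ suc e)
        ≤⟨ +-mono-≤ card-light Σout-bound ⟩
      T + T
        ≡⟨ cong (T +_) (sym (+-identityʳ T)) ⟩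
      2 * T ∎)
      where
      open ≤-Reasoning
      Cs = combinations n (suc t)
      N = suc n ^ suc t * 2
      Σout = ∑[ S ← Cs ] card (outlier? S)
      shuffle₁ : ∀ a b M w → 2 * ((a + b) * (M * w)) ≡ a * (M * (2 * w)) + b * (M * (2 * w))
      shuffle₁ = solve-∀
      anyOutlier? = λ x → anyˡ? (λ S → outlier? S x) Cs
      split : card (F? ∖? points? subcube) ≤ card light? + Σout
      split = ≤-trans (card-∪ (F? ∖? points? subcube) light? anyOutlier? light-or-outlier)
        (+-monoʳ-≤ (card light?) (card-⋃ anyOutlier? Cs outlier? (λ x a → find a)))
      Σout-bound : Σout * (M * 2 ^ suc e) ≤ T
      Σout-bound = *-cancelˡ-≤ N {{m*n≢0 (suc n ^ suc t) 2 {{m^n≢0 (suc n) (suc t)}}}} (begin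
        N * (Σout * (M * 2 ^ suc e))          ≡⟨ shuffle₂ N Σout M (2 ^ suc e) ⟩
        Σout * (N * 2 ^ suc e * M)            ≤⟨ *-monoʳ-≤ Σout (*-monoˡ-≤ M l-large) ⟩
        Σout * (2 ^ l * M)                    ≡⟨ sym (∑-*ʳ Cs (λ S → card (outlier? S)) (2 ^ l * M)) ⟩
        ∑[ S ← Cs ] (card (outlier? S) * (2 ^ l * M)) ≤⟨ ∑-bound Cs card-outliers ⟩
        length Cs * (2 * T)                   ≤⟨ *-monoˡ-≤ (2 * T) (length-combinations n (suc t)) ⟩
        suc n ^ suc t * (2 * T)               ≡⟨ sym (*-assoc (suc n ^ suc t) 2 T) ⟩
        N * T                                 ∎)
        where
        shuffle₂ : ∀ N s M w → N * (s * (M * w)) ≡ s * (N * w * M)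
        shuffle₂ = solve-∀

-- Choice of the parameters

n<2^n : ∀ n → n < 2 ^ n
n<2^n zero    = s≤s z≤n
n<2^n (suc n) = begin
  suc (suc n)          ≤⟨ +-mono-≤ (≤-trans (s≤s z≤n) (n<2^n n)) (n<2^n n) ⟩
  2 ^ n + 2 ^ n        ≡⟨ cong (2 ^ n +_) (sym (+-identityʳ (2 ^ n))) ⟩
  2 ^ suc n            ∎
  where open ≤-Reasoning

m<[1+m/n]*n : ∀ m n .{{_ : NonZero n}} → m < suc (m div n) * n
m<[1+m/n]*n m n = begin-strict
  m                          ≡⟨ m≡m%n+[m/n]*n m n ⟩
  m % n + m div n * n        <⟨ +-monoˡ-< (m div n * n) (m%n<n m n) ⟩
  suc (m div n) * n          ∎
  where open ≤-Reasoning

m*n≤o⇒m≤o/n : ∀ m n o .{{_ : NonZero n}} → m * n ≤ o → m ≤ o div n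
m*n≤o⇒m≤o/n m n o mn≤o = ≤-trans (≤-reflexive (sym (m*n/n≡m m n))) (/-monoˡ-≤ n mn≤o)

-- With p = n div (D C), the threshold ensures a D C ≤ p, whence a n ≤ p (p + 1) ≤ 4^p. The E-th
-- power is at most 2^(pD), and p D ≤ n div C. In D, `suc E` keeps the divisor positive when E is 0.
polynomial≤exponential : ∀ a E C .{{_ : NonZero C}} → ∃[ n₀ ] ∀ n → n₀ ≤ n → (a * n) ^ E ≤ 2 ^ (n div C)
polynomial≤exponential a E C = a * (D * C) * (D * C) , bound
  where
  D = 2 * suc E
  instance
    DC≢0 : NonZero (D * C)
    DC≢0 = m*n≢0 D C
  bound : ∀ n → a * (D * C) * (D * C) ≤ n → (a * n) ^ E ≤ 2 ^ (n div C)
  bound n n₀≤n = begin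
    (a * n) ^ E                     ≤⟨ ^-monoˡ-≤ E an≤ ⟩
    (2 ^ p * 2 ^ p) ^ E             ≡⟨ cong (_^ E) (sym (^-distribˡ-+-* 2 p p)) ⟩
    (2 ^ (p + p)) ^ E               ≡⟨ ^-*-assoc 2 (p + p) E ⟩
    2 ^ ((p + p) * E)               ≤⟨ ^-monoʳ-≤ 2 (≤-trans (*-monoʳ-≤ (p + p) (n≤1+n E)) (≤-reflexive (regroup p (suc E)))) ⟩
    2 ^ (p * D)                     ≤⟨ ^-monoʳ-≤ 2 (m*n≤o⇒m≤o/n (p * D) C n (≤-trans (≤-reflexive (*-assoc p D C)) (m/n*n≤m n (D * C)))) ⟩
    2 ^ (n div C)                     ∎
    where
    open ≤-Reasoning
    p = n div (D * C)
    regroup : ∀ p s → (p + p) * s ≡ p * (2 * s)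
    regroup = solve-∀
    swap : ∀ a p c → a * (p * c) ≡ a * c * p
    swap = solve-∀
    an≤ : a * n ≤ 2 ^ p * 2 ^ p
    an≤ = begin
      a * n                         ≤⟨ *-monoʳ-≤ a (<⇒≤ (m<[1+m/n]*n n (D * C))) ⟩
      a * (suc p * (D * C))         ≡⟨ swap a (suc p) (D * C) ⟩
      a * (D * C) * suc p           ≤⟨ *-monoˡ-≤ (suc p) (m*n≤o⇒m≤o/n (a * (D * C)) (D * C) n n₀≤n) ⟩
      p * suc p                     ≤⟨ *-mono-≤ (<⇒≤ (n<2^n p)) (n<2^n p) ⟩
      2 ^ p * 2 ^ p                 ∎

root : ∀ c .{{_ : NonZero c}} m → ∃[ h ] h ^ c ≤ m × m < suc h ^ c
root c@(suc _) zero    = 0 , z≤n , ≤-reflexive (sym (^-zeroˡ c))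
root c         (suc m) with h , h^c≤m , m<[1+h]^c ← root c m with suc h ^ c ≤? suc m
... | yes ≤m = suc h , ≤m , ≤-<-trans m<[1+h]^c (^-monoˡ-< c (n<1+n (suc h)))
... | no ≰m  = h , m≤n⇒m≤1+n h^c≤m , ≰⇒> ≰m

module Parameters (t N : ℕ) .{{_ : NonZero N}} where

  -- With h about m^(1/c), the density h^-d (up to polynomial factors) of F in
  -- heavy subcubes exceeds 1/m with room to spare, and h^(k - c) ≥ m^d.
  d c k E K : ℕ
  d = suc t
  c = 2 + d
  k = c + 2 * c * d
  E = 2 + k * suc d
  K = 4 * d * (c * N)

  instance
    cN≢0 : NonZero (c * N)
    cN≢0 = m*n≢0 c N
    K≢0 : NonZero K
    K≢0 = m*n≢0 (4 * d) (c * N)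

  n₀ : ℕ
  -- The base 12 d n comes from the factor 2 (3q + 3q) d n in `m-large`, and `E` dominates the
  -- exponents in `h-large`, `m-large` and `l-large`. The other summands give the blocks room and
  -- make q positive.
  n₀ = proj₁ (polynomial≤exponential (12 * d) E K) + (d * (2 + k) + K)

  module _ (m n : ℕ) .{{_ : NonZero m}} (n₀≤n : n₀ ≤ n) (2^n≤m^N : 2 ^ n ≤ m ^ N) where

    open ≤-Reasoning

    q h : ℕ
    q = n div K
    h = proj₁ (root c m)

    poly≤ : (12 * d * n) ^ E ≤ 2 ^ q
    poly≤ = proj₂ (polynomial≤exponential (12 * d) E K) n (≤-trans (m≤m+n _ _) n₀≤n)

    room₁ : d * (2 + k) ≤ n
    room₁ = ≤-trans (≤-trans (m≤m+n _ K) (m≤n+m _ _)) n₀≤n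

    1≤q : 1 ≤ q
    1≤q = m*n≤o⇒m≤o/n 1 K n (≤-trans (≤-reflexive (*-identityˡ K))
            (≤-trans (≤-trans (m≤n+m K (d * (2 + k))) (m≤n+m _ _)) n₀≤n))

    qK≤n : q * K ≤ n
    qK≤n = m/n*n≤m n K

    n≤eK : n ≤ suc q * K
    n≤eK = <⇒≤ (m<[1+m/n]*n n K)

    1≤n : 1 ≤ n
    1≤n = ≤-trans (s≤s z≤n) room₁

    instance
      n≢0 : NonZero n
      n≢0 = >-nonZero 1≤n

    -- Since q ≥ 1, at most 12 q portions of d coordinates are needed, and 12 d q ≤ q K because c N
    -- ≥ 3. This is where `K` needs its factor d.
    room₂ : d * (2 + (3 * q + 3 * q)) ≤ n
    room₂ = begin
      d * (2 + (3 * q + 3 * q))            ≤⟨ *-monoʳ-≤ d (+-monoˡ-≤ (3 * q + 3 * q) (≤-trans (m≤m+n 2 4) (*-monoʳ-≤ 6 1≤q))) ⟩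
      d * (6 * q + (3 * q + 3 * q))        ≡⟨ regroup d q ⟩
      q * (4 * d * 3)                      ≤⟨ *-monoʳ-≤ q (*-monoʳ-≤ (4 * d) (≤-trans (≤-trans (s≤s (s≤s (s≤s z≤n))) (m≤m*n c N)) ≤-refl)) ⟩
      q * K                                ≤⟨ qK≤n ⟩
      n                                    ∎
      where
      regroup : ∀ d q → d * (6 * q + (3 * q + 3 * q)) ≡ q * (4 * d * 3)
      regroup = solve-∀

    2≤2l : 2 ≤ 3 * q + 3 * q
    2≤2l = ≤-trans (m≤m+n 2 4) (+-mono-≤ (*-monoʳ-≤ 3 1≤q) (*-monoʳ-≤ 3 1≤q))

    -- If h + 1 were at most 2^(4dq), then m^N < (h+1)^(cN) ≤ 2^(qK) ≤ 2^n, against the lower bound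
    -- on m.
    2^[4q]≤h : 2 ^ (4 * q) ≤ h
    2^[4q]≤h = ≤-trans (^-monoʳ-≤ 2 (*-monoˡ-≤ q (m≤m*n 4 d))) (s≤s⁻¹ (≰⇒> λ 1+h≤ → <-irrefl refl (begin-strict
      2 ^ n                                ≤⟨ 2^n≤m^N ⟩
      m ^ N                                <⟨ ^-monoˡ-< N (proj₂ (proj₂ (root c m))) ⟩
      (suc h ^ c) ^ N                      ≡⟨ ^-*-assoc (suc h) c N ⟩
      suc h ^ (c * N)                      ≤⟨ ^-monoˡ-≤ (c * N) 1+h≤ ⟩
      (2 ^ (4 * d * q)) ^ (c * N)          ≡⟨ ^-*-assoc 2 (4 * d * q) (c * N) ⟩
      2 ^ (4 * d * q * (c * N))            ≡⟨ cong (2 ^_) (regroup (4 * d) q (c * N)) ⟩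
      2 ^ (q * K)                          ≤⟨ ^-monoʳ-≤ 2 qK≤n ⟩
      2 ^ n                                ∎)))
      where
      regroup : ∀ a b c → a * b * c ≡ b * (a * c)
      regroup = solve-∀

    poly≤h : (12 * d * n) ^ E ≤ h
    poly≤h = ≤-trans poly≤ (≤-trans (^-monoʳ-≤ 2 (m≤n*m q 4)) 2^[4q]≤h)

    W≤h : 2 ^ suc (suc q) ≤ h
    W≤h = ≤-trans (^-monoʳ-≤ 2 (begin
      2 + q            ≤⟨ +-monoˡ-≤ q (≤-trans (m≤m+n 2 1) (*-monoʳ-≤ 3 1≤q)) ⟩
      3 * q + q        ≡⟨ +-comm (3 * q) q ⟩
      4 * q            ∎)) 2^[4q]≤h

    instance
      h≢0 : NonZero h
      h≢0 = >-nonZero (≤-trans (m^n>0 2 (4 * q)) 2^[4q]≤h)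
      12dn≢0 : NonZero (12 * d * n)
      12dn≢0 = m*n≢0 (12 * d) n

    1+h≤h*h : suc h ≤ h * h
    1+h≤h*h = begin
      suc h            ≤⟨ +-monoˡ-≤ h (>-nonZero⁻¹ h) ⟩
      h + h            ≡⟨ cong (h +_) (sym (+-identityʳ h)) ⟩
      2 * h            ≤⟨ *-monoˡ-≤ h (≤-trans (^-monoʳ-≤ 2 {1} {4 * q} (≤-trans (s≤s z≤n) (*-monoʳ-≤ 4 1≤q))) 2^[4q]≤h) ⟩
      h * h            ∎

    h^c≤m : h ^ c ≤ m
    h^c≤m = proj₁ (proj₂ (root c m))

    m≤h^2c : m ≤ h ^ (2 * c)
    m≤h^2c = begin
      m                ≤⟨ <⇒≤ (proj₂ (proj₂ (root c m))) ⟩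
      suc h ^ c        ≤⟨ ^-monoˡ-≤ c 1+h≤h*h ⟩
      (h * h) ^ c      ≡⟨ cong (λ s → (h * s) ^ c) (sym (*-identityʳ h)) ⟩
      (h ^ 2) ^ c      ≡⟨ ^-*-assoc h 2 c ⟩
      h ^ (2 * c)      ∎

    2n≤12dn : 2 * n ≤ 12 * d * n
    2n≤12dn = *-monoˡ-≤ n (≤-trans (m≤m+n 2 10) (m≤m*n 12 d))

    private
      G : ℕ
      G = h * (2 * n) ^ k

      G^d : G ^ d ≡ h ^ d * (2 * n) ^ (k * d)
      G^d = trans (^-distribʳ-* h ((2 * n) ^ k) d) (cong (h ^ d *_) (^-*-assoc (2 * n) k d))

    -- Counting powers of h: d from G^d, one for all polynomial factors, 2cd for m^d, and one for
    -- 2^(q+2). As c = d + 2, they add up to k.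
    h-large : G ^ d * (2 * n) ^ k * (m ^ d * 2 ^ suc (suc q)) ≤ h ^ k
    h-large = begin
      G ^ d * (2 * n) ^ k * (m ^ d * 2 ^ suc (suc q))
        ≡⟨ cong (λ g → g * (2 * n) ^ k * (m ^ d * 2 ^ suc (suc q))) G^d ⟩
      h ^ d * (2 * n) ^ (k * d) * (2 * n) ^ k * (m ^ d * 2 ^ suc (suc q))
        ≡⟨ cong (_* (m ^ d * 2 ^ suc (suc q))) (trans (*-assoc (h ^ d) _ _)
             (cong (h ^ d *_) (sym (^-distribˡ-+-* (2 * n) (k * d) k)))) ⟩
      h ^ d * (2 * n) ^ (k * d + k) * (m ^ d * 2 ^ suc (suc q))
        ≤⟨ *-mono-≤ (*-monoʳ-≤ (h ^ d) (≤-trans (^-monoˡ-≤ (k * d + k) 2n≤12dn)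
             (≤-trans (^-monoʳ-≤ (12 * d * n) exponent) poly≤h)))
             (*-mono-≤ (≤-trans (^-monoˡ-≤ d m≤h^2c) (≤-reflexive (^-*-assoc h (2 * c) d))) W≤h) ⟩
      h ^ d * h * (h ^ (2 * c * d) * h)
        ≡⟨ regroup (h ^ d) h (h ^ (2 * c * d)) ⟩
      h ^ c * h ^ (2 * c * d)
        ≡⟨ sym (^-distribˡ-+-* h c (2 * c * d)) ⟩
      h ^ k ∎
      where
      exponent : k * d + k ≤ E
      exponent = ≤-trans (≤-reflexive (trans (+-comm (k * d) k) (sym (*-suc k d)))) (m≤n+m (k * suc d) 2)
      regroup : ∀ a h b → a * h * (b * h) ≡ h * (h * a) * b
      regroup = solve-∀

    -- The same budget: h^d from G^d, one h for the polynomial factors and one for 2^(q+2) make h^c,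
    -- which is at most m.
    m-large : 2 * ((3 * q + 3 * q) * (d * n)) * (G ^ d * 2 ^ suc (suc q)) ≤ m
    m-large = begin
      2 * ((3 * q + 3 * q) * (d * n)) * (G ^ d * 2 ^ suc (suc q))
        ≡⟨ cong (λ g → 2 * ((3 * q + 3 * q) * (d * n)) * (g * 2 ^ suc (suc q))) G^d ⟩
      2 * ((3 * q + 3 * q) * (d * n)) * (h ^ d * (2 * n) ^ (k * d) * 2 ^ suc (suc q))
        ≡⟨ regroup₁ q d n (h ^ d) ((2 * n) ^ (k * d)) (2 ^ suc (suc q)) ⟩
      q * (12 * d * n * (2 * n) ^ (k * d)) * (2 ^ suc (suc q) * h ^ d)
        ≤⟨ *-mono-≤ factor (*-monoˡ-≤ (h ^ d) W≤h) ⟩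
      h * (h * h ^ d)
        ≤⟨ h^c≤m ⟩
      m ∎
      where
      regroup₁ : ∀ q d n a b w → 2 * ((3 * q + 3 * q) * (d * n)) * (a * b * w) ≡ q * (12 * d * n * b) * (w * a)
      regroup₁ = solve-∀
      factor : q * (12 * d * n * (2 * n) ^ (k * d)) ≤ h
      factor = begin
        q * (12 * d * n * (2 * n) ^ (k * d))
          ≤⟨ *-mono-≤ (≤-trans (m≤m*n q K) (≤-trans qK≤n (m≤n*m n (12 * d)))) (*-monoʳ-≤ (12 * d * n) (^-monoˡ-≤ (k * d) 2n≤12dn)) ⟩
        (12 * d * n) ^ (2 + k * d)
          ≤⟨ ^-monoʳ-≤ (12 * d * n) (+-monoʳ-≤ 2 (*-monoʳ-≤ k (n≤1+n d))) ⟩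
        (12 * d * n) ^ E
          ≤⟨ poly≤h ⟩
        h ∎

    l-large : suc n ^ d * 2 * 2 ^ suc (suc q) ≤ 2 ^ (3 * q)
    l-large = begin
      suc n ^ d * 2 * 2 ^ suc (suc q)
        ≡⟨ regroup₁ (suc n ^ d) (2 ^ q) ⟩
      8 * suc n ^ d * 2 ^ q
        ≤⟨ *-monoˡ-≤ (2 ^ q) (*-mono-≤ 8≤ (^-monoˡ-≤ d 1+n≤)) ⟩
      (12 * d * n) ^ suc d * 2 ^ q
        ≤⟨ *-monoˡ-≤ (2 ^ q) (≤-trans (^-monoʳ-≤ (12 * d * n) suc-d≤E) poly≤) ⟩
      2 ^ q * 2 ^ q
        ≡⟨ sym (^-distribˡ-+-* 2 q q) ⟩
      2 ^ (q + q)
        ≤⟨ ^-monoʳ-≤ 2 (+-monoʳ-≤ q (m≤m+n q (q + 0))) ⟩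
      2 ^ (3 * q) ∎
      where
      regroup₁ : ∀ a w → a * 2 * (2 * (2 * w)) ≡ 8 * a * w
      regroup₁ = solve-∀
      8≤ : 8 ≤ 12 * d * n
      8≤ = ≤-trans (m≤m+n 8 4) (≤-trans (m≤m*n 12 d) (m≤m*n (12 * d) n))
      1+n≤ : suc n ≤ 12 * d * n
      1+n≤ = ≤-trans (+-monoˡ-≤ n 1≤n) (≤-trans (≤-reflexive (cong (n +_) (sym (+-identityʳ n)))) 2n≤12dn)
      suc-d≤E : suc d ≤ E
      suc-d≤E = ≤-trans (m≤n*m (suc d) k) (m≤n+m (k * suc d) 2)

-- Rational arithmetic

-- Not imported earlier: a prefix + makes sections such as (x +_) ambiguous.
open import Data.Integer using (+_)

-- The numerator and denominator as they stand, without cancellation; products and powers then have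
-- explicit ones, and comparisons reduce to natural numbers.
_≐_÷_ : ℚᵘ → ℕ → ℕ → Set
p ≐ a ÷ b = ℚᵘ.↥ p ≡ + a × ℚᵘ.↧ₙ p ≡ b

≐-/ : ∀ a b .{{_ : NonZero b}} → (+ a ℚᵘ./ b) ≐ a ÷ b
≐-/ a (suc b) = refl , refl

≐-* : ∀ {p q a b a′ b′} → p ≐ a ÷ b → q ≐ a′ ÷ b′ → (p ℚᵘ.* q) ≐ (a * a′) ÷ (b * b′)
≐-* {ℚᵘ.mkℚᵘ _ _} {ℚᵘ.mkℚᵘ _ _} {a} {_} {a′} (refl , refl) (refl , refl) = sym (pos-* a a′) , refl

≐-^ : ∀ {p a b} k → p ≐ a ÷ b → (p ^ᵘ k) ≐ (a ^ k) ÷ (b ^ k)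
≐-^ zero    _  = refl , refl
≐-^ {p} (suc k) p≐ = ≐-* {p} p≐ (≐-^ k p≐)

≐-≤ : ∀ {p q a b a′ b′} → p ≐ a ÷ b → q ≐ a′ ÷ b′ → a * b′ ≤ a′ * b → p ℚᵘ.≤ q
≐-≤ {ℚᵘ.mkℚᵘ _ u} {ℚᵘ.mkℚᵘ _ v} {a} {_} {a′} (refl , refl) (refl , refl) ab′≤a′b =
  ℚᵘ.*≤* (subst₂ ℤ._≤_ (pos-* a (suc v)) (pos-* a′ (suc u)) (ℤ.+≤+ ab′≤a′b))

μ-bound : ∀ {m n} .{{_ : NonZero m}} {P : Pred (Word m n) 0ℓ} (P? : Decidable P) (d e K : ℕ) .{{_ : NonZero K}} →
          card P? * (m ^ d * 2 ^ e) ≤ m ^ n → n ≤ e * K → μ P? ≤2^[- n / K ]* ((+ 1 ℚᵘ./ m) ^ᵘ d)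
μ-bound {m} {n} P? d e K small n≤eK = ≐-≤ {μ P? ^ᵘ K}
  (≐-^ K (≐-/ (card P?) (m ^ n) {{m^n≢0 m n}}))
  (≐-* {½ ^ᵘ n} (≐-^ {½} {1} {2} n (refl , refl)) (≐-^ {(+ 1 ℚᵘ./ m) ^ᵘ d} K (≐-^ {+ 1 ℚᵘ./ m} d (≐-/ 1 m))))
  (begin
    card P? ^ K * (2 ^ n * (m ^ d) ^ K)
      ≤⟨ *-monoʳ-≤ (card P? ^ K) (*-monoˡ-≤ ((m ^ d) ^ K) (^-monoʳ-≤ 2 n≤eK)) ⟩
    card P? ^ K * (2 ^ (e * K) * (m ^ d) ^ K)
      ≡⟨ cong (card P? ^ K *_) (trans (cong (_* (m ^ d) ^ K) (sym (^-*-assoc 2 e K))) (*-comm _ ((m ^ d) ^ K))) ⟩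
    card P? ^ K * ((m ^ d) ^ K * (2 ^ e) ^ K)
      ≡⟨ cong (card P? ^ K *_) (sym (^-distribʳ-* (m ^ d) (2 ^ e) K)) ⟩
    card P? ^ K * (m ^ d * 2 ^ e) ^ K
      ≡⟨ sym (^-distribʳ-* (card P?) (m ^ d * 2 ^ e) K) ⟩
    (card P? * (m ^ d * 2 ^ e)) ^ K
      ≤⟨ ^-monoˡ-≤ K small ⟩
    (m ^ n) ^ K
      ≡⟨ sym (trans (cong (_* (m ^ n) ^ K) ones) (*-identityˡ _)) ⟩
    1 ^ n * (1 ^ d) ^ K * (m ^ n) ^ K ∎)
  where
  open ≤-Reasoning
  ones : 1 ^ n * (1 ^ d) ^ K ≡ 1
  ones = trans (cong₂ _*_ (^-zeroˡ n) (trans (cong (_^ K) (^-zeroˡ d)) (^-zeroˡ K))) refl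

theorem7p14 : (t N : ℕ) .{{_ : NonZero t}} .{{_ : NonZero N}} →
    Σ[ K ∈ ℕ ] Σ[ K≢0 ∈ NonZero K ] ∃[ n₀ ]
    ((m n : ℕ) .{{_ : NonZero m}} (F : Pred (Word m n) 0ℓ) (F? : Decidable F) →
    Avoiding (pred t) F → n₀ ≤ n → 2^[ n / N ]≤ m →
    Σ[ D ∈ Subcube m n t ]
    _≤2^[-_/_]*_ (μ (F? ∖? points? D)) n K {{K≢0}} ((+ 1 / m) ^ᵘ t))
-- Here l = 3q, so 2l = 6q blocks are used, and e = q + 1. As q = n div K is rounded down, the extra
-- one is what gives 2^-e ≤ 2^(-n/K).
theorem7p14 (suc t) N = K , K≢0 , n₀ , λ m n F F? avoiding n₀≤n 2^n≤m^N →
  let instance h≢0′ = h≢0 m n n₀≤n 2^n≤m^N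
      open Structure.Conclusion t F? avoiding (h m n n₀≤n 2^n≤m^N) k (3 * q m n n₀≤n 2^n≤m^N) (suc (q m n n₀≤n 2^n≤m^N))
             (room₁ m n n₀≤n 2^n≤m^N) (room₂ m n n₀≤n 2^n≤m^N) (2≤2l m n n₀≤n 2^n≤m^N)
             (h-large m n n₀≤n 2^n≤m^N) (m-large m n n₀≤n 2^n≤m^N) (l-large m n n₀≤n 2^n≤m^N)
  in subcube , μ-bound (F? ∖? points? subcube) (suc t) (suc (q m n n₀≤n 2^n≤m^N)) K
                 card-outside (n≤eK m n n₀≤n 2^n≤m^N)
  where open Parameters t N
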